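{- Let $t\ge 0$ be an integer and let $T$ be a doubly-regular tournament of order $4t+3$. Then every arc of $T$ lies on exactly $2(t+1)(t-1)t^{2}(16t^{2}-4t-11)$ cycles of length $8$ in $T$.
   Context: A tournament of order $n$ is an orientation of the complete graph $K_n$; write $i\to j$ if $(i,j)$ is an arc. The out-set $N^{+}(i)$ (resp. in-set $N^{ - }(i)$) of a vertex $i$ is the set of vertices dominated by $i$ (resp. dominating $i$), and is also used to denote the subtournament it induces. A tournament is regular if every vertex has out-degree (and hence in-degree) $\delta=\frac{n-1}{2}$. A doubly-regular tournament of order $n$ is a regular tournament in which, for every vertex $i$, both $N^{+}(i)$ and $N^{ - }(i)$ induce regular tournaments of order $\delta$ (such tournaments exist only for $n\equiv 3 \pmod 4$). A cycle of length $m$ ($m$-cycle) is a directed cycle through $m$ distinct vertices, counted as a subgraph (not with a distinguished starting point). -}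

module Defs where

open import Data.Nat using (ℕ; zero; suc; _+_; _*_; _∸_; _^_)
open import Data.Bool using (Bool; true; false; _∧_; not; T)
open import Data.Fin using (Fin; _≟_)
open import Data.List using (List; []; _∷_; filter; length; map; concatMap; allFin)
open import Data.Vec using (Vec; []; _∷_)
open import Data.Product using (_×_)
open import Relation.Nullary.Decidable using (⌊_⌋)
open import Relation.Binary.PropositionalEquality using (_≡_; _≢_)
open import Function using (_∘_)

record Tournament (n : ℕ) : Set where
  field
    arc        : Fin n → Fin n → Bool
    irrefl     : ∀ i → arc i i ≡ false
    complete   : ∀ i j → i ≢ j → arc j i ≡ not (arc i j)
open Tournament public

Subset : ℕ → Set
Subset n = Fin n → Bool

count : {n : ℕ} → (Fin n → Bool) → ℕ
count {n} p = length (filter (λ x → T? (p x)) (allFin n))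
  where
  open import Data.Bool.Properties using () renaming (T? to T?)

outSet : {n : ℕ} → Tournament n → Fin n → Subset n
outSet τ i = arc τ i

inSet : {n : ℕ} → Tournament n → Fin n → Subset n
inSet τ i = λ j → arc τ j i

outDegIn : {n : ℕ} → Tournament n → Subset n → Fin n → ℕ
outDegIn τ S j = count (λ k → S k ∧ arc τ j k)

RegularOn : {n : ℕ} → Tournament n → Subset n → Set
RegularOn τ S = ∀ j → S j ≡ true → 2 * outDegIn τ S j + 1 ≡ count S

Regular : {n : ℕ} → Tournament n → Set
Regular τ = RegularOn τ (λ _ → true)

DoublyRegular : {n : ℕ} → Tournament n → Set
DoublyRegular τ = Regular τ × (∀ i → RegularOn τ (outSet τ i) × RegularOn τ (inSet τ i))

allVecs : (n k : ℕ) → List (Vec (Fin n) k)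
allVecs n zero = [] ∷ []
allVecs n (suc k) = concatMap (λ x → map (x ∷_) (allVecs n k)) (allFin n)

freshIn : {n k : ℕ} → Fin n → Vec (Fin n) k → Bool
freshIn x [] = true
freshIn x (y ∷ ys) = not ⌊ x ≟ y ⌋ ∧ freshIn x ys

distinct : {n k : ℕ} → Vec (Fin n) k → Bool
distinct [] = true
distinct (x ∷ xs) = freshIn x xs ∧ distinct xs

pathToClose : {n k : ℕ} → Tournament n → Fin n → Fin n → Vec (Fin n) k → Bool
pathToClose τ first x [] = arc τ x first
pathToClose τ first x (y ∷ ys) = arc τ x y ∧ pathToClose τ first y ys

isCycleSeq : {n k : ℕ} → Tournament n → Vec (Fin n) k → Bool
isCycleSeq τ [] = false
isCycleSeq τ (x ∷ xs) = distinct (x ∷ xs) ∧ pathToClose τ x x xs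

-- Number of m-cycles (m ≥ 2) of τ (as subgraphs) containing the arc u → v.
-- Such a cycle, traversed starting from u, is u → v → x₁ → … → x_{m-2} → u,
-- and this sequence determines the cycle uniquely; so cycles through the arc
-- correspond bijectively to the vectors (x₁,…,x_{m-2}) counted here.
cyclesThroughArc : {n : ℕ} → Tournament n → (m : ℕ) → Fin n → Fin n → ℕ
cyclesThroughArc {n} τ m u v =
  length (filter (λ w → T? (isCycleSeq τ (u ∷ v ∷ w))) (allVecs n (m ∸ 2)))
  where
  open import Data.Bool.Properties using () renaming (T? to T?)

{-# OPTIONS --safe #-}

-- The matrices I, A and Aᵀ of a doubly-regular tournament span an algebra that
-- is closed under the matrix product, with structure constants polynomial in t,
-- and under the entrywise product.  The 8-cycles through u → v are the
-- assignments x₂, …, x₇ for which all the labels of a complete network on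
-- u, v, x₂, …, x₇ hold: A along the cycle and J − I elsewhere.  A vertex with at
-- most two labels other than J can be summed out, which multiplies the label of
-- its two neighbours by a matrix product; a label J − I is removed by expanding
-- it, the term of I identifying its two ends.  For the 8-cycle there is always a
-- next vertex to sum out, so the count is a polynomial in t, found by
-- computation.
module Submission where

open import Defs
open import Data.Nat using (ℕ; zero; suc; _+_; _*_; _∸_; _^_)
open import Data.Fin using (Fin)
open import Data.Bool using (true)
open import Relation.Binary.PropositionalEquality using (_≡_)

import Data.Nat.Properties as ℕ
open import Data.Bool using (Bool; false; not; _∧_; if_then_else_)
open import Data.Bool.Properties using (∧-idem; T?)
open import Data.Fin using (zero; suc; _↑ˡ_; fromℕ; _≟_)
open import Data.Integer as ℤ using (ℤ; +_; -_; 0ℤ; 1ℤ)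
import Data.Integer.Properties as ℤ
open import Data.Integer.Tactic.RingSolver using (solve; solve-∀)
import Data.Nat.Tactic.RingSolver as ℕSolver
open import Data.List as List using (List; []; _∷_; filter; length; concatMap)
import Data.List.Properties as List
open import Data.Maybe as Maybe using (Maybe; just; nothing; _<∣>_; _>>=_)
open import Data.Product using (_×_; _,_; proj₁; proj₂; ∃)
open import Data.Product.Properties using (≡-dec)
import Data.Vec.Properties as Vec
open import Data.Vec as Vec using (Vec; []; _∷_; _++_; lookup; removeAt; updateAt; replicate; zipWith)
open import Relation.Binary using (DecidableEquality)
open import Relation.Binary.PropositionalEquality using (refl; sym; trans; cong; cong₂; module ≡-Reasoning)
open import Relation.Nullary using (Dec; yes; no; contradiction)
open import Relation.Nullary.Decidable using (⌊_⌋)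

open import Algebra.Properties.Semiring.Sum ℤ.+-*-semiring
  using (sum; sum-cong-≗; ∑-distrib-+; ∑-comm; *-distribˡ-sum; *-distribʳ-sum; sum-replicate-zero)
open ≡-Reasoning

-- The algebra says nothing about a sum over a vertex with three labels, which is why two is the
-- limit. Identifications threaten it: a merged vertex collects the labels of both its ends. No
-- general termination argument is given. `evaluate` is a partial procedure that returns a label
-- together with its correctness proof, and its success on the network of the 8-cycle is established
-- by running it inside a single `refl`. The size parameter t can stay a variable throughout,
-- because each decision of the procedure inspects labels only, and these are closed lists of
-- integer coefficients; t enters through the correctness proofs alone. Once all other vertices are
-- gone, a single label between u and v is left. Its coefficient at A is the count, so the count is
-- the same for every arc.

-- Integer polynomials as coefficient lists, lowest degree first.

Poly : Set
Poly = List ℤ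

infixl 6 _⊕_
infixl 7 _⊗_

_⊕_ : Poly → Poly → Poly
[]      ⊕ q       = q
(a ∷ p) ⊕ []      = a ∷ p
(a ∷ p) ⊕ (b ∷ q) = a ℤ.+ b ∷ p ⊕ q

-- shift [] = [] keeps [] the normal form of zero, so that zero labels are
-- recognised by syntactic equality.
shift : Poly → Poly
shift []        = []
shift p@(_ ∷ _) = 0ℤ ∷ p

scale : ℤ → Poly → Poly
scale c = List.map (c ℤ.*_)

_⊗_ : Poly → Poly → Poly
[]      ⊗ q = []
(a ∷ p) ⊗ q = scale a q ⊕ shift (p ⊗ q)

⟪_⟫ : Poly → ℤ → ℤ
⟪ [] ⟫    x = 0ℤ
⟪ a ∷ p ⟫ x = a ℤ.+ x ℤ.* ⟪ p ⟫ x

module _ (x : ℤ) where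

  ⟪⟫-⊕ : ∀ p q → ⟪ p ⊕ q ⟫ x ≡ ⟪ p ⟫ x ℤ.+ ⟪ q ⟫ x
  ⟪⟫-⊕ []      q       = sym (ℤ.+-identityˡ _)
  ⟪⟫-⊕ (a ∷ p) []      = sym (ℤ.+-identityʳ _)
  ⟪⟫-⊕ (a ∷ p) (b ∷ q) = begin
    a ℤ.+ b ℤ.+ x ℤ.* ⟪ p ⊕ q ⟫ x                 ≡⟨ cong (λ s → a ℤ.+ b ℤ.+ x ℤ.* s) (⟪⟫-⊕ p q) ⟩
    a ℤ.+ b ℤ.+ x ℤ.* (⟪ p ⟫ x ℤ.+ ⟪ q ⟫ x)       ≡⟨ rearrange a b x (⟪ p ⟫ x) (⟪ q ⟫ x) ⟩
    a ℤ.+ x ℤ.* ⟪ p ⟫ x ℤ.+ (b ℤ.+ x ℤ.* ⟪ q ⟫ x) ∎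
    where
    rearrange : ∀ a b x p q → a ℤ.+ b ℤ.+ x ℤ.* (p ℤ.+ q) ≡ a ℤ.+ x ℤ.* p ℤ.+ (b ℤ.+ x ℤ.* q)
    rearrange = solve-∀

  ⟪⟫-shift : ∀ p → ⟪ shift p ⟫ x ≡ x ℤ.* ⟪ p ⟫ x
  ⟪⟫-shift []      = sym (ℤ.*-zeroʳ x)
  ⟪⟫-shift (a ∷ p) = ℤ.+-identityˡ _

  ⟪⟫-scale : ∀ c p → ⟪ scale c p ⟫ x ≡ c ℤ.* ⟪ p ⟫ x
  ⟪⟫-scale c []      = sym (ℤ.*-zeroʳ c)
  ⟪⟫-scale c (a ∷ p) = begin
    c ℤ.* a ℤ.+ x ℤ.* ⟪ scale c p ⟫ x ≡⟨ cong (λ s → c ℤ.* a ℤ.+ x ℤ.* s) (⟪⟫-scale c p) ⟩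
    c ℤ.* a ℤ.+ x ℤ.* (c ℤ.* ⟪ p ⟫ x) ≡⟨ rearrange a c x (⟪ p ⟫ x) ⟩
    c ℤ.* (a ℤ.+ x ℤ.* ⟪ p ⟫ x)       ∎
    where
    rearrange : ∀ a c x p → c ℤ.* a ℤ.+ x ℤ.* (c ℤ.* p) ≡ c ℤ.* (a ℤ.+ x ℤ.* p)
    rearrange = solve-∀

  ⟪⟫-⊗ : ∀ p q → ⟪ p ⊗ q ⟫ x ≡ ⟪ p ⟫ x ℤ.* ⟪ q ⟫ x
  ⟪⟫-⊗ []      q = sym (ℤ.*-zeroˡ (⟪ q ⟫ x))
  ⟪⟫-⊗ (a ∷ p) q = begin
    ⟪ scale a q ⊕ shift (p ⊗ q) ⟫ x                    ≡⟨ ⟪⟫-⊕ (scale a q) (shift (p ⊗ q)) ⟩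
    ⟪ scale a q ⟫ x ℤ.+ ⟪ shift (p ⊗ q) ⟫ x            ≡⟨ cong₂ ℤ._+_ (⟪⟫-scale a q) (trans (⟪⟫-shift (p ⊗ q)) (cong (x ℤ.*_) (⟪⟫-⊗ p q))) ⟩
    a ℤ.* ⟪ q ⟫ x ℤ.+ x ℤ.* (⟪ p ⟫ x ℤ.* ⟪ q ⟫ x)      ≡⟨ rearrange a x (⟪ p ⟫ x) (⟪ q ⟫ x) ⟩
    (a ℤ.+ x ℤ.* ⟪ p ⟫ x) ℤ.* ⟪ q ⟫ x                  ∎
    where
    rearrange : ∀ a x p q → a ℤ.* q ℤ.+ x ℤ.* (p ℤ.* q) ≡ (a ℤ.+ x ℤ.* p) ℤ.* q
    rearrange = solve-∀

-- The algebra spanned by I, A and Aᵀ.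

-- (d , p , m) stands for d I + p A + m Aᵀ, where A is the adjacency matrix and
-- the coefficients are polynomials in t; 𝕁 is the all-ones matrix and 𝔻 = 𝕁 − I.
BoseMesner : Set
BoseMesner = Poly × Poly × Poly

_≟ᴮ_ : DecidableEquality BoseMesner
_≟ᴮ_ = ≡-dec _≟ᴾ_ (≡-dec _≟ᴾ_ _≟ᴾ_)
  where
  _≟ᴾ_ : DecidableEquality Poly
  _≟ᴾ_ = List.≡-dec ℤ._≟_

𝟘 𝕁 𝔻 𝔸 𝔸ᵀ : BoseMesner
𝟘  = [] , [] , []
𝕁  = 1ℤ ∷ [] , 1ℤ ∷ [] , 1ℤ ∷ []
𝔻 = [] , 1ℤ ∷ [] , 1ℤ ∷ []
𝔸  = [] , 1ℤ ∷ [] , []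
𝔸ᵀ = [] , [] , 1ℤ ∷ []

infixl 7 _∘ᴮ_ _⊙_
infixl 6 _⊞_ _⊝_

_ᵀ : BoseMesner → BoseMesner
(d , p , m) ᵀ = d , m , p

_∘ᴮ_ : BoseMesner → BoseMesner → BoseMesner
(d , p , m) ∘ᴮ (d′ , p′ , m′) = d ⊗ d′ , p ⊗ p′ , m ⊗ m′

_⊞_ : BoseMesner → BoseMesner → BoseMesner
(d , p , m) ⊞ (d′ , p′ , m′) = d ⊕ d′ , p ⊕ p′ , m ⊕ m′

_⊝_ : BoseMesner → BoseMesner → BoseMesner
r ⊝ (d , p , m) = r ⊞ (scale ℤ.-1ℤ d , scale ℤ.-1ℤ p , scale ℤ.-1ℤ m)

-- Read off from A Aᵀ = Aᵀ A = k I + λ₀ (A + Aᵀ) and A² = λ₀ A + λ₁ Aᵀ.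
product : Poly → Poly → Poly → BoseMesner → BoseMesner → BoseMesner
product k λ₀ λ₁ (d , p , m) (d′ , p′ , m′) =
  d ⊗ d′ ⊕ k ⊗ (p ⊗ p′ ⊕ m ⊗ m′) ,
  d ⊗ p′ ⊕ m ⊗ d′ ⊕ λ₀ ⊗ (p ⊗ p′ ⊕ m ⊗ m′ ⊕ m ⊗ p′) ⊕ λ₁ ⊗ (p ⊗ m′) ,
  d ⊗ m′ ⊕ p ⊗ d′ ⊕ λ₀ ⊗ (p ⊗ p′ ⊕ m ⊗ m′ ⊕ p ⊗ m′) ⊕ λ₁ ⊗ (m ⊗ p′)

-- The matrix product rᵀ s; the intersection numbers of the scheme are the
-- valency 2t + 1, and t and t + 1.
_⊙_ : BoseMesner → BoseMesner → BoseMesner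
_⊙_ = product (1ℤ ∷ + 2 ∷ []) (0ℤ ∷ 1ℤ ∷ []) (1ℤ ∷ 1ℤ ∷ [])

-- Networks of labels and their contractions.

-- A row holds the labels from one vertex to the later ones; the labels in the
-- other direction are the transposes.
data Net : ℕ → Set where
  []  : Net 0
  _▹_ : ∀ {k} → Vec BoseMesner k → Net k → Net (suc k)

infixr 5 _▹_

-- The labels from the overtaken vertices to vertex `i` are now read from the other end, hence the
-- transposes.
pull : ∀ {k} → Fin (suc k) → Net (suc k) → Net (suc k)
pull zero N = N
pull {suc k} (suc i) (es ▹ N) with pull i N
... | fs ▹ M = (lookup es i ᵀ ∷ fs) ▹ removeAt es i ▹ M

overlay : ∀ {k} → Net k → Net k → Net k
overlay []       []       = []
overlay (es ▹ M) (fs ▹ N) = zipWith _∘ᴮ_ es fs ▹ overlay M N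

allDistinct : ∀ k → Net k
allDistinct zero    = []
allDistinct (suc k) = replicate k 𝔻 ▹ allDistinct k

chain : ∀ k → Net k
chain zero          = []
chain (suc zero)    = [] ▹ []
chain (suc (suc k)) = (𝔸 ∷ replicate k 𝕁) ▹ chain (suc k)

-- The row of the first vertex: its only condition is the returning arc from the last vertex, which
-- seen from the first is Aᵀ.
closing : ∀ k → Vec BoseMesner (suc k)
closing zero    = 𝔸ᵀ ∷ []
closing (suc k) = 𝕁 ∷ closing k

cycleNet : ∀ k → Net (2 + k)
cycleNet k = overlay (allDistinct (2 + k)) (zipWith _∘ᴮ_ (closing k) (𝔸 ∷ replicate k 𝕁) ▹ chain (suc k))

soften : BoseMesner → BoseMesner
soften e with e ≟ᴮ 𝔻
... | yes _ = 𝕁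
... | no  _ = e

-- A pair (i , N) is the network in which the first vertex, with row es, has been
-- identified with the i-th remaining one.  Each label J − I of es gives one such
-- pair; the labels J − I before it have been replaced by J already.
extend : ∀ {k} → BoseMesner → Vec BoseMesner k → Fin k × Net k → Fin (suc k) × Net (suc k)
extend e fs (i , N) = suc i , updateAt fs i (_∘ᴮ e ᵀ) ▹ N

contractions : ∀ {k} → Vec BoseMesner k → Net k → List (Fin k × Net k)
contractions [] [] = []
contractions (e ∷ es) (fs ▹ N) with e ≟ᴮ 𝔻
-- The merged vertex has towards each later vertex the entrywise product of the two former labels.
... | yes _ = (zero , zipWith _∘ᴮ_ es fs ▹ N) ∷ List.map (extend 𝕁 fs) (contractions es N)
... | no  _ = List.map (extend e fs) (contractions es N)

-- The expansion of 2 (t + 1)(t - 1) t² (16 t² - 4 t - 11). It has to agree with the computed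
-- coefficient list literally, not only in value.
octagons : Poly
octagons = 0ℤ ∷ 0ℤ ∷ + 22 ∷ + 8 ∷ - + 54 ∷ - + 8 ∷ + 32 ∷ []

-- Indicators and sums over a finite set.

ind : Bool → ℤ
ind b = if b then 1ℤ else 0ℤ

ind-∧ : ∀ b c → ind (b ∧ c) ≡ ind b ℤ.* ind c
ind-∧ true  c = sym (ℤ.*-identityˡ _)
ind-∧ false c = refl

length-filter-tabulate : ∀ {A : Set} {n} (p : A → Bool) (f : Fin n → A) →
  + length (filter (λ x → T? (p x)) (List.tabulate f)) ≡ sum (λ i → ind (p (f i)))
length-filter-tabulate {n = zero}  p f = refl
length-filter-tabulate {n = suc n} p f with p (f zero)
... | true  = cong (λ s → 1ℤ ℤ.+ s) (length-filter-tabulate p (λ i → f (suc i)))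
... | false = trans (length-filter-tabulate p (λ i → f (suc i))) (sym (ℤ.+-identityˡ _))

count-ind : ∀ {n} (p : Fin n → Bool) → + count p ≡ sum (λ i → ind (p i))
count-ind p = length-filter-tabulate p (λ i → i)

sum-linear : ∀ {n} c d (f g : Fin n → ℤ) →
  sum (λ x → c ℤ.* f x ℤ.+ d ℤ.* g x) ≡ c ℤ.* sum f ℤ.+ d ℤ.* sum g
sum-linear c d f g =
  trans (∑-distrib-+ (λ x → c ℤ.* f x) (λ x → d ℤ.* g x))
        (cong₂ ℤ._+_ (sym (*-distribˡ-sum c f)) (sym (*-distribˡ-sum d g)))

sum-linear₃ : ∀ {n} c d e (f g h : Fin n → ℤ) →
  sum (λ x → c ℤ.* f x ℤ.+ d ℤ.* g x ℤ.+ e ℤ.* h x) ≡ c ℤ.* sum f ℤ.+ d ℤ.* sum g ℤ.+ e ℤ.* sum h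
sum-linear₃ c d e f g h =
  trans (∑-distrib-+ (λ x → c ℤ.* f x ℤ.+ d ℤ.* g x) (λ x → e ℤ.* h x))
        (cong₂ ℤ._+_ (sum-linear c d f g) (sym (*-distribˡ-sum e h)))

sum-minus : ∀ {n} (f g : Fin n → ℤ) → sum (λ x → f x ℤ.- g x) ≡ sum f ℤ.- sum g
sum-minus f g = begin
  sum (λ x → f x ℤ.- g x)                            ≡⟨ sum-cong-≗ (λ x → as-linear (f x) (g x)) ⟩
  sum (λ x → 1ℤ ℤ.* f x ℤ.+ ℤ.-1ℤ ℤ.* g x)           ≡⟨ sum-linear 1ℤ ℤ.-1ℤ f g ⟩
  1ℤ ℤ.* sum f ℤ.+ ℤ.-1ℤ ℤ.* sum g                   ≡⟨ sym (as-linear (sum f) (sum g)) ⟩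
  sum f ℤ.- sum g                                    ∎
  where
  as-linear : ∀ a b → a ℤ.- b ≡ 1ℤ ℤ.* a ℤ.+ ℤ.-1ℤ ℤ.* b
  as-linear = solve-∀

δ : ∀ {n} → Fin n → Fin n → ℤ
δ i j = ind ⌊ i ≟ j ⌋

δ-sym : ∀ {n} (i j : Fin n) → δ i j ≡ δ j i
δ-sym i j with i ≟ j | j ≟ i
... | yes _    | yes _    = refl
... | no _     | no _     = refl
... | yes refl | no j≢j   = contradiction refl j≢j
... | no i≢i   | yes refl = contradiction refl i≢i

δ-subst : ∀ {n} (i j : Fin n) (f : Fin n → ℤ) → δ i j ℤ.* f i ≡ δ i j ℤ.* f j
δ-subst i j f with i ≟ j
... | yes refl = refl
... | no _     = refl

sum-δ : ∀ {n} (i : Fin n) (f : Fin n → ℤ) → sum (λ x → δ x i ℤ.* f x) ≡ f i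
sum-δ {suc n} zero f = begin
  1ℤ ℤ.* f zero ℤ.+ sum (λ x → 0ℤ ℤ.* f (suc x)) ≡⟨ cong₂ ℤ._+_ (ℤ.*-identityˡ (f zero)) (sum-replicate-zero n) ⟩
  f zero ℤ.+ 0ℤ                                  ≡⟨ ℤ.+-identityʳ _ ⟩
  f zero                                         ∎
sum-δ {suc n} (suc i) f = begin
  0ℤ ℤ.* f zero ℤ.+ sum (λ x → δ (suc x) (suc i) ℤ.* f (suc x)) ≡⟨ ℤ.+-identityˡ _ ⟩
  sum (λ x → δ (suc x) (suc i) ℤ.* f (suc x))                   ≡⟨ sum-cong-≗ (λ x → cong (ℤ._* f (suc x)) (δ-suc x)) ⟩
  sum (λ x → δ x i ℤ.* f (suc x))                               ≡⟨ sum-δ i (λ x → f (suc x)) ⟩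
  f (suc i)                                                     ∎
  where
  δ-suc : ∀ x → δ (suc x) (suc i) ≡ δ x i
  δ-suc x with x ≟ i
  ... | yes _ = refl
  ... | no  _ = refl

-- Sums over the vertices of an arbitrary tournament.

-- Values of (I, A, Aᵀ) at a pair of vertices of a tournament.
data Position : ℤ → ℤ → ℤ → Set where
  equal   : Position 1ℤ 0ℤ 0ℤ
  forward : Position 0ℤ 1ℤ 0ℤ
  back    : Position 0ℤ 0ℤ 1ℤ

module _ {n} (τ : Tournament n) where

  adj : Fin n → Fin n → ℤ
  adj i j = ind (arc τ i j)

  -- Reduces an identity between entries of I, A and Aᵀ to three ring identities, one for each
  -- triple of values.
  position : ∀ i j → Position (δ i j) (adj i j) (adj j i)
  position i j with i ≟ j
  ... | yes refl rewrite irrefl τ i = equal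
  ... | no i≢j rewrite complete τ i j i≢j with arc τ i j
  ...   | true  = forward
  ...   | false = back

  adj-complement : ∀ c i j → c ℤ.* adj i j ≡ 1ℤ ℤ.* c ℤ.+ ℤ.-1ℤ ℤ.* (δ i j ℤ.* c) ℤ.+ ℤ.-1ℤ ℤ.* (c ℤ.* adj j i)
  adj-complement c i j = by-position c (position i j)
    where
    by-position : ∀ c {e f b} → Position e f b →
      c ℤ.* f ≡ 1ℤ ℤ.* c ℤ.+ ℤ.-1ℤ ℤ.* (e ℤ.* c) ℤ.+ ℤ.-1ℤ ℤ.* (c ℤ.* b)
    by-position c equal   = solve (c List.∷ List.[])
    by-position c forward = solve (c List.∷ List.[])
    by-position c back    = solve (c List.∷ List.[])

  -- This is A = J - I - Aᵀ under a sum. It turns counts of out-neighbours into counts of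
  -- in-neighbours, so that every intersection number follows from out-degrees and common
  -- out-neighbours.
  sum-complement : ∀ (f : Fin n → ℤ) j →
    sum (λ x → f x ℤ.* adj x j) ≡ 1ℤ ℤ.* sum f ℤ.+ ℤ.-1ℤ ℤ.* f j ℤ.+ ℤ.-1ℤ ℤ.* sum (λ x → f x ℤ.* adj j x)
  sum-complement f j = begin
    sum (λ x → f x ℤ.* adj x j)
      ≡⟨ sum-cong-≗ (λ x → adj-complement (f x) x j) ⟩
    sum (λ x → 1ℤ ℤ.* f x ℤ.+ ℤ.-1ℤ ℤ.* (δ x j ℤ.* f x) ℤ.+ ℤ.-1ℤ ℤ.* (f x ℤ.* adj j x))
      ≡⟨ sum-linear₃ 1ℤ ℤ.-1ℤ ℤ.-1ℤ f (λ x → δ x j ℤ.* f x) (λ x → f x ℤ.* adj j x) ⟩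
    1ℤ ℤ.* sum f ℤ.+ ℤ.-1ℤ ℤ.* sum (λ x → δ x j ℤ.* f x) ℤ.+ ℤ.-1ℤ ℤ.* sum (λ x → f x ℤ.* adj j x)
      ≡⟨ cong (λ s → 1ℤ ℤ.* sum f ℤ.+ ℤ.-1ℤ ℤ.* s ℤ.+ ℤ.-1ℤ ℤ.* sum (λ x → f x ℤ.* adj j x)) (sum-δ j f) ⟩
    1ℤ ℤ.* sum f ℤ.+ ℤ.-1ℤ ℤ.* f j ℤ.+ ℤ.-1ℤ ℤ.* sum (λ x → f x ℤ.* adj j x) ∎

  combination : ℤ → ℤ → ℤ → Fin n → Fin n → ℤ
  combination d p m i j = d ℤ.* δ i j ℤ.+ p ℤ.* adj i j ℤ.+ m ℤ.* adj j i

  combination-cong : ∀ {d d′ p p′ m m′} → d ≡ d′ → p ≡ p′ → m ≡ m′ → ∀ i j →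
    combination d p m i j ≡ combination d′ p′ m′ i j
  combination-cong refl refl refl i j = refl

  sum-combination : ∀ (f : Fin n → ℤ) d p m j →
    sum (λ x → f x ℤ.* combination d p m x j) ≡
    d ℤ.* f j ℤ.+ p ℤ.* sum (λ x → f x ℤ.* adj x j) ℤ.+ m ℤ.* sum (λ x → f x ℤ.* adj j x)
  sum-combination f d p m j = begin
    sum (λ x → f x ℤ.* combination d p m x j)
      ≡⟨ sum-cong-≗ (λ x → distribute (f x) d p m (δ x j) (adj x j) (adj j x)) ⟩
    sum (λ x → d ℤ.* (δ x j ℤ.* f x) ℤ.+ p ℤ.* (f x ℤ.* adj x j) ℤ.+ m ℤ.* (f x ℤ.* adj j x))
      ≡⟨ sum-linear₃ d p m (λ x → δ x j ℤ.* f x) (λ x → f x ℤ.* adj x j) (λ x → f x ℤ.* adj j x) ⟩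
    d ℤ.* sum (λ x → δ x j ℤ.* f x) ℤ.+ p ℤ.* sum (λ x → f x ℤ.* adj x j) ℤ.+ m ℤ.* sum (λ x → f x ℤ.* adj j x)
      ≡⟨ cong (λ s → d ℤ.* s ℤ.+ p ℤ.* sum (λ x → f x ℤ.* adj x j) ℤ.+ m ℤ.* sum (λ x → f x ℤ.* adj j x)) (sum-δ j f) ⟩
    d ℤ.* f j ℤ.+ p ℤ.* sum (λ x → f x ℤ.* adj x j) ℤ.+ m ℤ.* sum (λ x → f x ℤ.* adj j x) ∎
    where
    distribute : ∀ f d p m e a b →
      f ℤ.* (d ℤ.* e ℤ.+ p ℤ.* a ℤ.+ m ℤ.* b) ≡ d ℤ.* (e ℤ.* f) ℤ.+ p ℤ.* (f ℤ.* a) ℤ.+ m ℤ.* (f ℤ.* b)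
    distribute = solve-∀

sum-1 : ∀ n → sum {n} (λ _ → 1ℤ) ≡ + n
sum-1 zero    = refl
sum-1 (suc n) = cong (λ s → 1ℤ ℤ.+ s) (sum-1 n)

sum-comm : ∀ {n} (f g : Fin n → ℤ) → sum (λ x → f x ℤ.* g x) ≡ sum (λ x → g x ℤ.* f x)
sum-comm f g = sum-cong-≗ (λ x → ℤ.*-comm (f x) (g x))

-- Iterated sums and counting of vectors.

∑ : ∀ {n} m → (Vec (Fin n) m → ℤ) → ℤ
∑ zero    F = F []
∑ (suc m) F = sum (λ x → ∑ m (λ xs → F (x ∷ xs)))

length-filter-concatMap : ∀ {A B : Set} {n} (p : B → Bool) (f : A → List B) (g : Fin n → A) →
  + length (filter (λ y → T? (p y)) (concatMap f (List.tabulate g))) ≡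
  sum (λ i → + length (filter (λ y → T? (p y)) (f (g i))))
length-filter-concatMap {n = zero}  p f g = refl
length-filter-concatMap {n = suc n} p f g = begin
  + length (filter P? (f (g zero) List.++ rest))
    ≡⟨ cong (λ ys → + length ys) (List.filter-++ P? (f (g zero)) rest) ⟩
  + length (filter P? (f (g zero)) List.++ filter P? rest)
    ≡⟨ cong +_ (List.length-++ (filter P? (f (g zero)))) ⟩
  + length (filter P? (f (g zero))) ℤ.+ + length (filter P? rest)
    ≡⟨ cong (λ s → + length (filter P? (f (g zero))) ℤ.+ s) (length-filter-concatMap p f (λ i → g (suc i))) ⟩
  + length (filter P? (f (g zero))) ℤ.+ sum (λ i → + length (filter P? (f (g (suc i))))) ∎
  where
  P? = λ y → T? (p y)
  rest = concatMap f (List.tabulate (λ i → g (suc i)))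

length-filter-map : ∀ {A B : Set} (p : B → Bool) (f : A → B) xs →
  length (filter (λ y → T? (p y)) (List.map f xs)) ≡ length (filter (λ x → T? (p (f x))) xs)
length-filter-map p f []       = refl
length-filter-map p f (x ∷ xs) with p (f x)
... | true  = cong suc (length-filter-map p f xs)
... | false = length-filter-map p f xs

length-filter-allVecs : ∀ {n} k (p : Vec (Fin n) k → Bool) →
  + length (filter (λ xs → T? (p xs)) (allVecs n k)) ≡ ∑ k (λ xs → ind (p xs))
length-filter-allVecs zero p with p []
... | true  = refl
... | false = refl
length-filter-allVecs {n} (suc k) p =
  trans (length-filter-concatMap p (λ x → List.map (x ∷_) (allVecs n k)) (λ x → x))
        (sum-cong-≗ (λ x → trans (cong +_ (length-filter-map p (x ∷_) (allVecs n k)))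
                                 (length-filter-allVecs k (λ xs → p (x ∷ xs)))))

∑-cong : ∀ {n} m {F G : Vec (Fin n) m → ℤ} → (∀ xs → F xs ≡ G xs) → ∑ m F ≡ ∑ m G
∑-cong zero    F≡G = F≡G []
∑-cong (suc m) F≡G = sum-cong-≗ (λ x → ∑-cong m (λ xs → F≡G (x ∷ xs)))

∑-zero : ∀ {n} m → ∑ {n} m (λ _ → 0ℤ) ≡ 0ℤ
∑-zero     zero    = refl
∑-zero {n} (suc m) = trans (sum-cong-≗ {n} (λ x → ∑-zero m)) (sum-replicate-zero n)

∑-plus : ∀ {n} m (F G : Vec (Fin n) m → ℤ) → ∑ m (λ xs → F xs ℤ.+ G xs) ≡ ∑ m F ℤ.+ ∑ m G
∑-plus zero    F G = refl
∑-plus (suc m) F G =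
  trans (sum-cong-≗ (λ x → ∑-plus m (λ xs → F (x ∷ xs)) (λ xs → G (x ∷ xs))))
        (∑-distrib-+ (λ x → ∑ m (λ xs → F (x ∷ xs))) (λ x → ∑ m (λ xs → G (x ∷ xs))))

∑-minus : ∀ {n} m (F G : Vec (Fin n) m → ℤ) → ∑ m (λ xs → F xs ℤ.- G xs) ≡ ∑ m F ℤ.- ∑ m G
∑-minus zero    F G = refl
∑-minus (suc m) F G =
  trans (sum-cong-≗ (λ x → ∑-minus m (λ xs → F (x ∷ xs)) (λ xs → G (x ∷ xs))))
        (sum-minus (λ x → ∑ m (λ xs → F (x ∷ xs))) (λ x → ∑ m (λ xs → G (x ∷ xs))))

sum-∑ : ∀ {n} m (F : Fin n → Vec (Fin n) m → ℤ) →
  sum (λ x → ∑ m (F x)) ≡ ∑ m (λ xs → sum (λ x → F x xs))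
sum-∑ zero    F = refl
sum-∑ (suc m) F =
  trans (∑-comm (λ x y → ∑ m (λ xs → F x (y ∷ xs))))
        (sum-cong-≗ (λ y → sum-∑ m (λ x xs → F x (y ∷ xs))))

front : ∀ {A : Set} {k} → Fin (suc k) → Vec A (suc k) → Vec A (suc k)
front i xs = lookup xs i ∷ removeAt xs i

-- Only the order of summation changes: `i` is one of the summed coordinates, and the fixed `ys`
-- stay at the end.
∑-front : ∀ {n k} m i (F : Vec (Fin n) (suc m + k) → ℤ) ys →
  ∑ (suc m) (λ xs → F (front (i ↑ˡ k) (xs ++ ys))) ≡ ∑ (suc m) (λ xs → F (xs ++ ys))
∑-front m       zero    F ys = refl
∑-front (suc m) (suc i) F ys =
  trans (sum-cong-≗ (λ x → ∑-front m i (λ zs → F (Vec.head zs ∷ x ∷ Vec.tail zs)) ys))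
        (∑-comm (λ x z → ∑ m (λ xs → F (z ∷ x ∷ xs ++ ys))))

firstJust : ∀ {A : Set} {n} → (Fin n → Maybe A) → Maybe A
firstJust {n = zero}  f = nothing
firstJust {n = suc n} f = f zero <∣> firstJust (λ i → f (suc i))

module DoublyRegularTournament (t : ℕ) (τ : Tournament (4 * t + 3)) (dr : DoublyRegular τ) where

  Vertex : Set
  Vertex = Fin (4 * t + 3)

  T : ℤ
  T = + t

  a : Vertex → Vertex → ℤ
  a = adj τ

  -- Degrees and intersection numbers of a doubly-regular tournament.

  count-out : ∀ i → count (arc τ i) ≡ 2 * t + 1
  count-out i = ℕ.*-cancelˡ-≡ _ _ 2 (ℕ.+-cancelʳ-≡ 1 _ _ (begin
    2 * count (arc τ i) + 1 ≡⟨ proj₁ dr i refl ⟩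
    count {4 * t + 3} (λ _ → true)      ≡⟨ ℤ.+-injective (trans (count-ind {4 * t + 3} (λ _ → true)) (sum-1 (4 * t + 3))) ⟩
    4 * t + 3               ≡⟨ ℕSolver.solve (t List.∷ List.[]) ⟩
    2 * (2 * t + 1) + 1     ∎))

  out-degree : ∀ i → sum (a i) ≡ + 2 ℤ.* T ℤ.+ 1ℤ
  out-degree i = begin
    sum (a i)            ≡⟨ sym (count-ind (arc τ i)) ⟩
    + count (arc τ i)    ≡⟨ cong +_ (count-out i) ⟩
    + (2 * t) ℤ.+ 1ℤ     ≡⟨ cong (ℤ._+ 1ℤ) (ℤ.pos-* 2 t) ⟩
    + 2 ℤ.* T ℤ.+ 1ℤ     ∎

  -- The sum is the out-degree of j inside the out-set of i, which is regular of order 2t + 1.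
  common-out-of-arc : ∀ i j → arc τ i j ≡ true → sum (λ x → a i x ℤ.* a j x) ≡ T
  common-out-of-arc i j i→j = begin
    sum (λ x → a i x ℤ.* a j x)           ≡⟨ sum-cong-≗ (λ x → sym (ind-∧ (arc τ i x) (arc τ j x))) ⟩
    sum (λ x → ind (arc τ i x ∧ arc τ j x)) ≡⟨ sym (count-ind (λ x → arc τ i x ∧ arc τ j x)) ⟩
    + outDegIn τ (outSet τ i) j           ≡⟨ cong +_ (ℕ.*-cancelˡ-≡ _ _ 2 (ℕ.+-cancelʳ-≡ 1 _ _ regular)) ⟩
    T                                     ∎
    where
    regular : 2 * outDegIn τ (outSet τ i) j + 1 ≡ 2 * t + 1
    regular = trans (proj₁ (proj₂ dr i) j i→j) (count-out i)

  -- In matrix form, A Aᵀ = (2t + 1) I + t (A + Aᵀ). Of two distinct vertices one dominates the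
  -- other, and the sum is symmetric in them.
  common-out : ∀ i j → sum (λ x → a i x ℤ.* a j x) ≡ (+ 2 ℤ.* T ℤ.+ 1ℤ) ℤ.* δ i j ℤ.+ T ℤ.* (a i j ℤ.+ a j i)
  common-out i j with i ≟ j
  ... | yes refl = begin
    sum (λ x → a i x ℤ.* a i x)                   ≡⟨ sum-cong-≗ (λ x → trans (sym (ind-∧ (arc τ i x) _)) (cong ind (∧-idem (arc τ i x)))) ⟩
    sum (a i)                                     ≡⟨ out-degree i ⟩
    + 2 ℤ.* T ℤ.+ 1ℤ                              ≡⟨ pad T ⟩
    (+ 2 ℤ.* T ℤ.+ 1ℤ) ℤ.* 1ℤ ℤ.+ T ℤ.* (0ℤ ℤ.+ 0ℤ)
      ≡⟨ cong (λ s → (+ 2 ℤ.* T ℤ.+ 1ℤ) ℤ.* 1ℤ ℤ.+ T ℤ.* (s ℤ.+ s)) (sym (cong ind (irrefl τ i))) ⟩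
    (+ 2 ℤ.* T ℤ.+ 1ℤ) ℤ.* 1ℤ ℤ.+ T ℤ.* (a i i ℤ.+ a i i) ∎
    where
    pad : ∀ T → + 2 ℤ.* T ℤ.+ 1ℤ ≡ (+ 2 ℤ.* T ℤ.+ 1ℤ) ℤ.* 1ℤ ℤ.+ T ℤ.* (0ℤ ℤ.+ 0ℤ)
    pad = solve-∀
  ... | no i≢j =
    trans (distinct-common-out (arc τ i j) refl)
          (cong (λ s → (+ 2 ℤ.* T ℤ.+ 1ℤ) ℤ.* 0ℤ ℤ.+ T ℤ.* (a i j ℤ.+ ind s)) (sym (complete τ i j i≢j)))
    where
    pad : ∀ T → T ≡ (+ 2 ℤ.* T ℤ.+ 1ℤ) ℤ.* 0ℤ ℤ.+ T ℤ.* 1ℤ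
    pad = solve-∀
    distinct-common-out : ∀ b → arc τ i j ≡ b →
      sum (λ x → a i x ℤ.* a j x) ≡ (+ 2 ℤ.* T ℤ.+ 1ℤ) ℤ.* 0ℤ ℤ.+ T ℤ.* (ind (arc τ i j) ℤ.+ ind (not (arc τ i j)))
    distinct-common-out true  i→j = begin
      sum (λ x → a i x ℤ.* a j x)               ≡⟨ common-out-of-arc i j i→j ⟩
      T                                         ≡⟨ pad T ⟩
      (+ 2 ℤ.* T ℤ.+ 1ℤ) ℤ.* 0ℤ ℤ.+ T ℤ.* 1ℤ    ≡⟨ cong (λ b → (+ 2 ℤ.* T ℤ.+ 1ℤ) ℤ.* 0ℤ ℤ.+ T ℤ.* (ind b ℤ.+ ind (not b))) (sym i→j) ⟩
      _                                         ∎
    distinct-common-out false i↛j = begin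
      sum (λ x → a i x ℤ.* a j x)               ≡⟨ sum-comm (a i) (a j) ⟩
      sum (λ x → a j x ℤ.* a i x)               ≡⟨ common-out-of-arc j i (trans (complete τ i j i≢j) (cong not i↛j)) ⟩
      T                                         ≡⟨ pad T ⟩
      (+ 2 ℤ.* T ℤ.+ 1ℤ) ℤ.* 0ℤ ℤ.+ T ℤ.* 1ℤ    ≡⟨ cong (λ b → (+ 2 ℤ.* T ℤ.+ 1ℤ) ℤ.* 0ℤ ℤ.+ T ℤ.* (ind b ℤ.+ ind (not b))) (sym i↛j) ⟩
      _                                         ∎

  -- A² = A (J - I - Aᵀ), where A J is known from the out-degrees and A Aᵀ from `common-out`.
  two-paths : ∀ i j → sum (λ x → a i x ℤ.* a x j) ≡ T ℤ.* a i j ℤ.+ (T ℤ.+ 1ℤ) ℤ.* a j i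
  two-paths i j = begin
    sum (λ x → a i x ℤ.* a x j)
      ≡⟨ sum-complement τ (a i) j ⟩
    1ℤ ℤ.* sum (a i) ℤ.+ ℤ.-1ℤ ℤ.* a i j ℤ.+ ℤ.-1ℤ ℤ.* sum (λ x → a i x ℤ.* a j x)
      ≡⟨ cong₂ (λ r s → 1ℤ ℤ.* r ℤ.+ ℤ.-1ℤ ℤ.* a i j ℤ.+ ℤ.-1ℤ ℤ.* s) (out-degree i) (common-out i j) ⟩
    1ℤ ℤ.* (+ 2 ℤ.* T ℤ.+ 1ℤ) ℤ.+ ℤ.-1ℤ ℤ.* a i j ℤ.+ ℤ.-1ℤ ℤ.* ((+ 2 ℤ.* T ℤ.+ 1ℤ) ℤ.* δ i j ℤ.+ T ℤ.* (a i j ℤ.+ a j i))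
      ≡⟨ by-position T (position τ i j) ⟩
    T ℤ.* a i j ℤ.+ (T ℤ.+ 1ℤ) ℤ.* a j i ∎
    where
    by-position : ∀ T {e f b} → Position e f b →
      1ℤ ℤ.* (+ 2 ℤ.* T ℤ.+ 1ℤ) ℤ.+ ℤ.-1ℤ ℤ.* f ℤ.+ ℤ.-1ℤ ℤ.* ((+ 2 ℤ.* T ℤ.+ 1ℤ) ℤ.* e ℤ.+ T ℤ.* (f ℤ.+ b)) ≡
      T ℤ.* f ℤ.+ (T ℤ.+ 1ℤ) ℤ.* b
    by-position T equal   = solve (T List.∷ List.[])
    by-position T forward = solve (T List.∷ List.[])
    by-position T back    = solve (T List.∷ List.[])

  in-degree : ∀ j → sum (λ x → a x j) ≡ + 2 ℤ.* T ℤ.+ 1ℤ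
  in-degree j = begin
    sum (λ x → a x j)
      ≡⟨ sum-cong-≗ (λ x → sym (ℤ.*-identityˡ (a x j))) ⟩
    sum (λ x → 1ℤ ℤ.* a x j)
      ≡⟨ sum-complement τ (λ _ → 1ℤ) j ⟩
    1ℤ ℤ.* sum {4 * t + 3} (λ _ → 1ℤ) ℤ.+ ℤ.-1ℤ ℤ.* 1ℤ ℤ.+ ℤ.-1ℤ ℤ.* sum (λ x → 1ℤ ℤ.* a j x)
      ≡⟨ cong₂ (λ r s → 1ℤ ℤ.* r ℤ.+ ℤ.-1ℤ ℤ.* 1ℤ ℤ.+ ℤ.-1ℤ ℤ.* s)
               (trans (sum-1 (4 * t + 3)) (cong (ℤ._+ + 3) (ℤ.pos-* 4 t)))
               (trans (sum-cong-≗ (λ x → ℤ.*-identityˡ (a j x))) (out-degree j)) ⟩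
    1ℤ ℤ.* (+ 4 ℤ.* T ℤ.+ + 3) ℤ.+ ℤ.-1ℤ ℤ.* 1ℤ ℤ.+ ℤ.-1ℤ ℤ.* (+ 2 ℤ.* T ℤ.+ 1ℤ)
      ≡⟨ simplify T ⟩
    + 2 ℤ.* T ℤ.+ 1ℤ ∎
    where
    simplify : ∀ T → 1ℤ ℤ.* (+ 4 ℤ.* T ℤ.+ + 3) ℤ.+ ℤ.-1ℤ ℤ.* 1ℤ ℤ.+ ℤ.-1ℤ ℤ.* (+ 2 ℤ.* T ℤ.+ 1ℤ) ≡ + 2 ℤ.* T ℤ.+ 1ℤ
    simplify = solve-∀

  -- Aᵀ A = Aᵀ (J - I - Aᵀ), where Aᵀ J is known from the in-degrees and (Aᵀ)² is the transpose of
  -- A².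
  common-in : ∀ i j → sum (λ x → a x i ℤ.* a x j) ≡ (+ 2 ℤ.* T ℤ.+ 1ℤ) ℤ.* δ i j ℤ.+ T ℤ.* (a i j ℤ.+ a j i)
  common-in i j = begin
    sum (λ x → a x i ℤ.* a x j)
      ≡⟨ sum-complement τ (λ x → a x i) j ⟩
    1ℤ ℤ.* sum (λ x → a x i) ℤ.+ ℤ.-1ℤ ℤ.* a j i ℤ.+ ℤ.-1ℤ ℤ.* sum (λ x → a x i ℤ.* a j x)
      ≡⟨ cong₂ (λ r s → 1ℤ ℤ.* r ℤ.+ ℤ.-1ℤ ℤ.* a j i ℤ.+ ℤ.-1ℤ ℤ.* s) (in-degree i)
               (trans (sum-comm (λ x → a x i) (a j)) (two-paths j i)) ⟩
    1ℤ ℤ.* (+ 2 ℤ.* T ℤ.+ 1ℤ) ℤ.+ ℤ.-1ℤ ℤ.* a j i ℤ.+ ℤ.-1ℤ ℤ.* (T ℤ.* a j i ℤ.+ (T ℤ.+ 1ℤ) ℤ.* a i j)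
      ≡⟨ by-position T (position τ i j) ⟩
    (+ 2 ℤ.* T ℤ.+ 1ℤ) ℤ.* δ i j ℤ.+ T ℤ.* (a i j ℤ.+ a j i) ∎
    where
    by-position : ∀ T {e f b} → Position e f b →
      1ℤ ℤ.* (+ 2 ℤ.* T ℤ.+ 1ℤ) ℤ.+ ℤ.-1ℤ ℤ.* b ℤ.+ ℤ.-1ℤ ℤ.* (T ℤ.* b ℤ.+ (T ℤ.+ 1ℤ) ℤ.* f) ≡
      (+ 2 ℤ.* T ℤ.+ 1ℤ) ℤ.* e ℤ.+ T ℤ.* (f ℤ.+ b)
    by-position T equal   = solve (T List.∷ List.[])
    by-position T forward = solve (T List.∷ List.[])
    by-position T back    = solve (T List.∷ List.[])

  -- Labels as matrices over the vertices.

  entry : BoseMesner → Vertex → Vertex → ℤ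
  entry (d , p , m) = combination τ (⟪ d ⟫ T) (⟪ p ⟫ T) (⟪ m ⟫ T)

  entry-𝕁 : ∀ i j → entry 𝕁 i j ≡ 1ℤ
  entry-𝕁 i j = by-position T (position τ i j)
    where
    by-position : ∀ T {e f b} → Position e f b →
      (1ℤ ℤ.+ T ℤ.* 0ℤ) ℤ.* e ℤ.+ (1ℤ ℤ.+ T ℤ.* 0ℤ) ℤ.* f ℤ.+ (1ℤ ℤ.+ T ℤ.* 0ℤ) ℤ.* b ≡ 1ℤ
    by-position T equal   = solve (T List.∷ List.[])
    by-position T forward = solve (T List.∷ List.[])
    by-position T back    = solve (T List.∷ List.[])

  entry-𝔻 : ∀ i j → entry 𝔻 i j ≡ 1ℤ ℤ.- δ i j
  entry-𝔻 i j = by-position T (position τ i j)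
    where
    by-position : ∀ T {e f b} → Position e f b →
      0ℤ ℤ.* e ℤ.+ (1ℤ ℤ.+ T ℤ.* 0ℤ) ℤ.* f ℤ.+ (1ℤ ℤ.+ T ℤ.* 0ℤ) ℤ.* b ≡ 1ℤ ℤ.- e
    by-position T equal   = solve (T List.∷ List.[])
    by-position T forward = solve (T List.∷ List.[])
    by-position T back    = solve (T List.∷ List.[])

  entry-𝔸 : ∀ i j → entry 𝔸 i j ≡ a i j
  entry-𝔸 i j = simplify T (δ i j) (a i j) (a j i)
    where
    simplify : ∀ T e f b → 0ℤ ℤ.* e ℤ.+ (1ℤ ℤ.+ T ℤ.* 0ℤ) ℤ.* f ℤ.+ 0ℤ ℤ.* b ≡ f
    simplify = solve-∀

  entry-ᵀ : ∀ r i j → entry (r ᵀ) i j ≡ entry r j i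
  entry-ᵀ (d , p , m) i j = begin
    ⟪ d ⟫ T ℤ.* δ i j ℤ.+ ⟪ m ⟫ T ℤ.* a i j ℤ.+ ⟪ p ⟫ T ℤ.* a j i
      ≡⟨ swap (⟪ d ⟫ T ℤ.* δ i j) (⟪ m ⟫ T ℤ.* a i j) (⟪ p ⟫ T ℤ.* a j i) ⟩
    ⟪ d ⟫ T ℤ.* δ i j ℤ.+ ⟪ p ⟫ T ℤ.* a j i ℤ.+ ⟪ m ⟫ T ℤ.* a i j
      ≡⟨ cong (λ s → ⟪ d ⟫ T ℤ.* s ℤ.+ ⟪ p ⟫ T ℤ.* a j i ℤ.+ ⟪ m ⟫ T ℤ.* a i j) (δ-sym i j) ⟩
    ⟪ d ⟫ T ℤ.* δ j i ℤ.+ ⟪ p ⟫ T ℤ.* a j i ℤ.+ ⟪ m ⟫ T ℤ.* a i j ∎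
    where
    swap : ∀ x y z → x ℤ.+ y ℤ.+ z ≡ x ℤ.+ z ℤ.+ y
    swap = solve-∀

  entry-𝔸ᵀ : ∀ i j → entry 𝔸ᵀ i j ≡ a j i
  entry-𝔸ᵀ i j = trans (entry-ᵀ 𝔸 i j) (entry-𝔸 j i)

  -- I, A and Aᵀ are 0-1 matrices with disjoint supports, hence orthogonal idempotents for the
  -- entrywise product.
  entry-∘ : ∀ r s i j → entry (r ∘ᴮ s) i j ≡ entry r i j ℤ.* entry s i j
  entry-∘ (d , p , m) (d′ , p′ , m′) i j = begin
    entry (d ⊗ d′ , p ⊗ p′ , m ⊗ m′) i j
      ≡⟨ combination-cong τ (⟪⟫-⊗ T d d′) (⟪⟫-⊗ T p p′) (⟪⟫-⊗ T m m′) i j ⟩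
    _ ≡⟨ by-position (⟪ d ⟫ T) (⟪ p ⟫ T) (⟪ m ⟫ T) (⟪ d′ ⟫ T) (⟪ p′ ⟫ T) (⟪ m′ ⟫ T) (position τ i j) ⟩
    entry (d , p , m) i j ℤ.* entry (d′ , p′ , m′) i j ∎
    where
    by-position : ∀ d p m d′ p′ m′ {e f b} → Position e f b →
      d ℤ.* d′ ℤ.* e ℤ.+ p ℤ.* p′ ℤ.* f ℤ.+ m ℤ.* m′ ℤ.* b ≡
      (d ℤ.* e ℤ.+ p ℤ.* f ℤ.+ m ℤ.* b) ℤ.* (d′ ℤ.* e ℤ.+ p′ ℤ.* f ℤ.+ m′ ℤ.* b)
    by-position d p m d′ p′ m′ equal   = solve (d List.∷ p List.∷ m List.∷ d′ List.∷ p′ List.∷ m′ List.∷ List.[])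
    by-position d p m d′ p′ m′ forward = solve (d List.∷ p List.∷ m List.∷ d′ List.∷ p′ List.∷ m′ List.∷ List.[])
    by-position d p m d′ p′ m′ back    = solve (d List.∷ p List.∷ m List.∷ d′ List.∷ p′ List.∷ m′ List.∷ List.[])

  entry-⊞ : ∀ r s i j → entry (r ⊞ s) i j ≡ entry r i j ℤ.+ entry s i j
  entry-⊞ (d , p , m) (d′ , p′ , m′) i j = begin
    entry ((d , p , m) ⊞ (d′ , p′ , m′)) i j
      ≡⟨ combination-cong τ (⟪⟫-⊕ T d d′) (⟪⟫-⊕ T p p′) (⟪⟫-⊕ T m m′) i j ⟩
    _ ≡⟨ rearrange (⟪ d ⟫ T) (⟪ p ⟫ T) (⟪ m ⟫ T) (⟪ d′ ⟫ T) (⟪ p′ ⟫ T) (⟪ m′ ⟫ T) (δ i j) (a i j) (a j i) ⟩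
    entry (d , p , m) i j ℤ.+ entry (d′ , p′ , m′) i j ∎
    where
    rearrange : ∀ d p m d′ p′ m′ e f b →
      (d ℤ.+ d′) ℤ.* e ℤ.+ (p ℤ.+ p′) ℤ.* f ℤ.+ (m ℤ.+ m′) ℤ.* b ≡
      (d ℤ.* e ℤ.+ p ℤ.* f ℤ.+ m ℤ.* b) ℤ.+ (d′ ℤ.* e ℤ.+ p′ ℤ.* f ℤ.+ m′ ℤ.* b)
    rearrange = solve-∀

  entry-⊝ : ∀ r s i j → entry (r ⊝ s) i j ≡ entry r i j ℤ.- entry s i j
  entry-⊝ r (d , p , m) i j = begin
    entry (r ⊝ (d , p , m)) i j
      ≡⟨ entry-⊞ r (scale ℤ.-1ℤ d , scale ℤ.-1ℤ p , scale ℤ.-1ℤ m) i j ⟩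
    entry r i j ℤ.+ entry (scale ℤ.-1ℤ d , scale ℤ.-1ℤ p , scale ℤ.-1ℤ m) i j
      ≡⟨ cong (λ s → entry r i j ℤ.+ s) (combination-cong τ (⟪⟫-scale T ℤ.-1ℤ d) (⟪⟫-scale T ℤ.-1ℤ p) (⟪⟫-scale T ℤ.-1ℤ m) i j) ⟩
    _ ≡⟨ rearrange (entry r i j) (⟪ d ⟫ T) (⟪ p ⟫ T) (⟪ m ⟫ T) (δ i j) (a i j) (a j i) ⟩
    entry r i j ℤ.- entry (d , p , m) i j ∎
    where
    rearrange : ∀ r d p m e f b →
      r ℤ.+ ((ℤ.-1ℤ ℤ.* d) ℤ.* e ℤ.+ (ℤ.-1ℤ ℤ.* p) ℤ.* f ℤ.+ (ℤ.-1ℤ ℤ.* m) ℤ.* b) ≡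
      r ℤ.- (d ℤ.* e ℤ.+ p ℤ.* f ℤ.+ m ℤ.* b)
    rearrange = solve-∀

  infix  4 _⇓_
  infixl 6 _⟨⊕⟩_
  infixl 7 _⟨⊗⟩_

  -- A wrapper that lets Agda infer p from the type of a proof of p ⇓ x.
  record _⇓_ (p : Poly) (x : ℤ) : Set where
    constructor evaluates
    field value-of : ⟪ p ⟫ T ≡ x
  open _⇓_

  ⟨_⟩ : ∀ p → p ⇓ ⟪ p ⟫ T
  ⟨ p ⟩ = evaluates refl

  _⟨⊕⟩_ : ∀ {p q x y} → p ⇓ x → q ⇓ y → p ⊕ q ⇓ x ℤ.+ y
  _⟨⊕⟩_ {p} {q} (evaluates refl) (evaluates refl) = evaluates (⟪⟫-⊕ T p q)

  _⟨⊗⟩_ : ∀ {p q x y} → p ⇓ x → q ⇓ y → p ⊗ q ⇓ x ℤ.* y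
  _⟨⊗⟩_ {p} {q} (evaluates refl) (evaluates refl) = evaluates (⟪⟫-⊗ T p q)

  -- The intersection numbers are variables here so that `⊗` does not unfold on their lists and the
  -- polynomials can be inferred by unification. The actual lists are supplied in `sum-entry`.
  entry-product : ∀ k λ₀ λ₁ d p m d′ p′ m′ i j →
    entry (product k λ₀ λ₁ (d , p , m) (d′ , p′ , m′)) i j ≡
    combination τ
      (⟪ d ⟫ T ℤ.* ⟪ d′ ⟫ T ℤ.+ ⟪ k ⟫ T ℤ.* (⟪ p ⟫ T ℤ.* ⟪ p′ ⟫ T ℤ.+ ⟪ m ⟫ T ℤ.* ⟪ m′ ⟫ T))
      (⟪ d ⟫ T ℤ.* ⟪ p′ ⟫ T ℤ.+ ⟪ m ⟫ T ℤ.* ⟪ d′ ⟫ T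
        ℤ.+ ⟪ λ₀ ⟫ T ℤ.* (⟪ p ⟫ T ℤ.* ⟪ p′ ⟫ T ℤ.+ ⟪ m ⟫ T ℤ.* ⟪ m′ ⟫ T ℤ.+ ⟪ m ⟫ T ℤ.* ⟪ p′ ⟫ T)
        ℤ.+ ⟪ λ₁ ⟫ T ℤ.* (⟪ p ⟫ T ℤ.* ⟪ m′ ⟫ T))
      (⟪ d ⟫ T ℤ.* ⟪ m′ ⟫ T ℤ.+ ⟪ p ⟫ T ℤ.* ⟪ d′ ⟫ T
        ℤ.+ ⟪ λ₀ ⟫ T ℤ.* (⟪ p ⟫ T ℤ.* ⟪ p′ ⟫ T ℤ.+ ⟪ m ⟫ T ℤ.* ⟪ m′ ⟫ T ℤ.+ ⟪ p ⟫ T ℤ.* ⟪ m′ ⟫ T)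
        ℤ.+ ⟪ λ₁ ⟫ T ℤ.* (⟪ m ⟫ T ℤ.* ⟪ p′ ⟫ T)) i j
  entry-product k λ₀ λ₁ d p m d′ p′ m′ i j =
    combination-cong τ
      (value-of (⟨ d ⟩ ⟨⊗⟩ ⟨ d′ ⟩ ⟨⊕⟩ ⟨ k ⟩ ⟨⊗⟩ (⟨ p ⟩ ⟨⊗⟩ ⟨ p′ ⟩ ⟨⊕⟩ ⟨ m ⟩ ⟨⊗⟩ ⟨ m′ ⟩)))
      (value-of (⟨ d ⟩ ⟨⊗⟩ ⟨ p′ ⟩ ⟨⊕⟩ ⟨ m ⟩ ⟨⊗⟩ ⟨ d′ ⟩
        ⟨⊕⟩ ⟨ λ₀ ⟩ ⟨⊗⟩ (⟨ p ⟩ ⟨⊗⟩ ⟨ p′ ⟩ ⟨⊕⟩ ⟨ m ⟩ ⟨⊗⟩ ⟨ m′ ⟩ ⟨⊕⟩ ⟨ m ⟩ ⟨⊗⟩ ⟨ p′ ⟩)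
        ⟨⊕⟩ ⟨ λ₁ ⟩ ⟨⊗⟩ (⟨ p ⟩ ⟨⊗⟩ ⟨ m′ ⟩)))
      (value-of (⟨ d ⟩ ⟨⊗⟩ ⟨ m′ ⟩ ⟨⊕⟩ ⟨ p ⟩ ⟨⊗⟩ ⟨ d′ ⟩
        ⟨⊕⟩ ⟨ λ₀ ⟩ ⟨⊗⟩ (⟨ p ⟩ ⟨⊗⟩ ⟨ p′ ⟩ ⟨⊕⟩ ⟨ m ⟩ ⟨⊗⟩ ⟨ m′ ⟩ ⟨⊕⟩ ⟨ p ⟩ ⟨⊗⟩ ⟨ m′ ⟩)
        ⟨⊕⟩ ⟨ λ₁ ⟩ ⟨⊗⟩ (⟨ m ⟩ ⟨⊗⟩ ⟨ p′ ⟩)))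
      i j

  -- Both labels start at the vertex summed out, so the first matrix is transposed. Bilinearity
  -- leaves four sums of products of adjacencies, all known.
  sum-entry : ∀ r s i j → sum (λ x → entry r x i ℤ.* entry s x j) ≡ entry (r ⊙ s) i j
  sum-entry r@(d , p , m) s@(d′ , p′ , m′) i j = begin
    sum (λ x → entry r x i ℤ.* entry s x j)
      ≡⟨ sum-combination τ (λ x → entry r x i) (⟪ d′ ⟫ T) (⟪ p′ ⟫ T) (⟪ m′ ⟫ T) j ⟩
    ⟪ d′ ⟫ T ℤ.* entry r j i ℤ.+ ⟪ p′ ⟫ T ℤ.* sum (λ x → entry r x i ℤ.* a x j) ℤ.+ ⟪ m′ ⟫ T ℤ.* sum (λ x → entry r x i ℤ.* a j x)
      ≡⟨ cong₂ (λ y z → ⟪ d′ ⟫ T ℤ.* entry r j i ℤ.+ ⟪ p′ ⟫ T ℤ.* y ℤ.+ ⟪ m′ ⟫ T ℤ.* z)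
           (trans (sum-comm (λ x → entry r x i) (λ x → a x j)) (sum-combination τ (λ x → a x j) (⟪ d ⟫ T) (⟪ p ⟫ T) (⟪ m ⟫ T) i))
           (trans (sum-comm (λ x → entry r x i) (a j)) (sum-combination τ (a j) (⟪ d ⟫ T) (⟪ p ⟫ T) (⟪ m ⟫ T) i)) ⟩
    expanded (δ j i)
      (sum (λ x → a x j ℤ.* a x i)) (sum (λ x → a x j ℤ.* a i x))
      (sum (λ x → a j x ℤ.* a x i)) (sum (λ x → a j x ℤ.* a i x))
      ≡⟨ expanded-cong (δ-sym j i)
           (trans (sum-comm (λ x → a x j) (λ x → a x i)) (common-in i j))
           (trans (sum-comm (λ x → a x j) (a i)) (two-paths i j))
           (two-paths j i)
           (trans (sum-comm (a j) (a i)) (common-out i j)) ⟩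
    _ ≡⟨ by-position T (⟪ d ⟫ T) (⟪ p ⟫ T) (⟪ m ⟫ T) (⟪ d′ ⟫ T) (⟪ p′ ⟫ T) (⟪ m′ ⟫ T) (position τ i j) ⟩
    _ ≡⟨ sym (entry-product (1ℤ ∷ + 2 ∷ []) (0ℤ ∷ 1ℤ ∷ []) (1ℤ ∷ 1ℤ ∷ []) d p m d′ p′ m′ i j) ⟩
    entry (r ⊙ s) i j ∎
    where
    expanded : ℤ → ℤ → ℤ → ℤ → ℤ → ℤ
    expanded e in-in in-out out-in out-out =
      ⟪ d′ ⟫ T ℤ.* (⟪ d ⟫ T ℤ.* e ℤ.+ ⟪ p ⟫ T ℤ.* a j i ℤ.+ ⟪ m ⟫ T ℤ.* a i j)
      ℤ.+ ⟪ p′ ⟫ T ℤ.* (⟪ d ⟫ T ℤ.* a i j ℤ.+ ⟪ p ⟫ T ℤ.* in-in ℤ.+ ⟪ m ⟫ T ℤ.* in-out)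
      ℤ.+ ⟪ m′ ⟫ T ℤ.* (⟪ d ⟫ T ℤ.* a j i ℤ.+ ⟪ p ⟫ T ℤ.* out-in ℤ.+ ⟪ m ⟫ T ℤ.* out-out)
    expanded-cong : ∀ {e e′ w w′ x x′ y y′ z z′} → e ≡ e′ → w ≡ w′ → x ≡ x′ → y ≡ y′ → z ≡ z′ →
      expanded e w x y z ≡ expanded e′ w′ x′ y′ z′
    expanded-cong refl refl refl refl refl = refl
    -- The factors with `T ℤ.* 0ℤ` are the coefficient lists of 2t + 1, t and t + 1 as `⟪_⟫`
    -- evaluates them.
    by-position : ∀ T d p m d′ p′ m′ {e f b} → Position e f b →
      d′ ℤ.* (d ℤ.* e ℤ.+ p ℤ.* b ℤ.+ m ℤ.* f)
      ℤ.+ p′ ℤ.* (d ℤ.* f ℤ.+ p ℤ.* ((+ 2 ℤ.* T ℤ.+ 1ℤ) ℤ.* e ℤ.+ T ℤ.* (f ℤ.+ b)) ℤ.+ m ℤ.* (T ℤ.* f ℤ.+ (T ℤ.+ 1ℤ) ℤ.* b))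
      ℤ.+ m′ ℤ.* (d ℤ.* b ℤ.+ p ℤ.* (T ℤ.* b ℤ.+ (T ℤ.+ 1ℤ) ℤ.* f) ℤ.+ m ℤ.* ((+ 2 ℤ.* T ℤ.+ 1ℤ) ℤ.* e ℤ.+ T ℤ.* (f ℤ.+ b)))
      ≡
      (d ℤ.* d′ ℤ.+ (1ℤ ℤ.+ T ℤ.* (+ 2 ℤ.+ T ℤ.* 0ℤ)) ℤ.* (p ℤ.* p′ ℤ.+ m ℤ.* m′)) ℤ.* e
      ℤ.+ (d ℤ.* p′ ℤ.+ m ℤ.* d′
            ℤ.+ (0ℤ ℤ.+ T ℤ.* (1ℤ ℤ.+ T ℤ.* 0ℤ)) ℤ.* (p ℤ.* p′ ℤ.+ m ℤ.* m′ ℤ.+ m ℤ.* p′)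
            ℤ.+ (1ℤ ℤ.+ T ℤ.* (1ℤ ℤ.+ T ℤ.* 0ℤ)) ℤ.* (p ℤ.* m′)) ℤ.* f
      ℤ.+ (d ℤ.* m′ ℤ.+ p ℤ.* d′
            ℤ.+ (0ℤ ℤ.+ T ℤ.* (1ℤ ℤ.+ T ℤ.* 0ℤ)) ℤ.* (p ℤ.* p′ ℤ.+ m ℤ.* m′ ℤ.+ p ℤ.* m′)
            ℤ.+ (1ℤ ℤ.+ T ℤ.* (1ℤ ℤ.+ T ℤ.* 0ℤ)) ℤ.* (m ℤ.* p′)) ℤ.* b
    by-position T d p m d′ p′ m′ equal   = solve (T List.∷ d List.∷ p List.∷ m List.∷ d′ List.∷ p′ List.∷ m′ List.∷ List.[])
    by-position T d p m d′ p′ m′ forward = solve (T List.∷ d List.∷ p List.∷ m List.∷ d′ List.∷ p′ List.∷ m′ List.∷ List.[])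
    by-position T d p m d′ p′ m′ back    = solve (T List.∷ d List.∷ p List.∷ m List.∷ d′ List.∷ p′ List.∷ m′ List.∷ List.[])

  -- The value of a network at an assignment of vertices.

  star : ∀ {k} → Vec BoseMesner k → Vertex → Vec Vertex k → ℤ
  star []       x []       = 1ℤ
  star (e ∷ es) x (y ∷ ys) = entry e x y ℤ.* star es x ys

  value : ∀ {k} → Net k → Vec Vertex k → ℤ
  value []       []       = 1ℤ
  value (es ▹ N) (x ∷ xs) = star es x xs ℤ.* value N xs

  private
    interchange : ∀ w x y z → (w ℤ.* x) ℤ.* (y ℤ.* z) ≡ (w ℤ.* y) ℤ.* (x ℤ.* z)
    interchange = solve-∀

    left-comm : ∀ x y z → x ℤ.* (y ℤ.* z) ≡ y ℤ.* (x ℤ.* z)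
    left-comm = solve-∀

  star-𝕁 : ∀ {k} x (ys : Vec Vertex k) → star (replicate k 𝕁) x ys ≡ 1ℤ
  star-𝕁 x []       = refl
  star-𝕁 x (y ∷ ys) = cong₂ ℤ._*_ (entry-𝕁 x y) (star-𝕁 x ys)

  𝕁-star : ∀ {k} (es : Vec BoseMesner k) x y ys → entry 𝕁 x y ℤ.* star es x ys ≡ star es x ys
  𝕁-star es x y ys = trans (cong (ℤ._* star es x ys) (entry-𝕁 x y)) (ℤ.*-identityˡ (star es x ys))

  star-zipWith : ∀ {k} (es fs : Vec BoseMesner k) x ys →
    star (zipWith _∘ᴮ_ es fs) x ys ≡ star es x ys ℤ.* star fs x ys
  star-zipWith []       []       x []       = refl
  star-zipWith (e ∷ es) (f ∷ fs) x (y ∷ ys) = begin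
    entry (e ∘ᴮ f) x y ℤ.* star (zipWith _∘ᴮ_ es fs) x ys
      ≡⟨ cong₂ ℤ._*_ (entry-∘ e f x y) (star-zipWith es fs x ys) ⟩
    (entry e x y ℤ.* entry f x y) ℤ.* (star es x ys ℤ.* star fs x ys)
      ≡⟨ interchange (entry e x y) (entry f x y) (star es x ys) (star fs x ys) ⟩
    (entry e x y ℤ.* star es x ys) ℤ.* (entry f x y ℤ.* star fs x ys) ∎

  star-updateAt : ∀ {k} (es : Vec BoseMesner k) i f x ys →
    star (updateAt es i (_∘ᴮ f)) x ys ≡ star es x ys ℤ.* entry f x (lookup ys i)
  star-updateAt (e ∷ es) zero f x (y ∷ ys) = begin
    entry (e ∘ᴮ f) x y ℤ.* star es x ys            ≡⟨ cong (ℤ._* star es x ys) (entry-∘ e f x y) ⟩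
    entry e x y ℤ.* entry f x y ℤ.* star es x ys   ≡⟨ rotate (entry e x y) (entry f x y) (star es x ys) ⟩
    entry e x y ℤ.* star es x ys ℤ.* entry f x y   ∎
    where
    rotate : ∀ x y z → x ℤ.* y ℤ.* z ≡ x ℤ.* z ℤ.* y
    rotate = solve-∀
  star-updateAt (e ∷ es) (suc i) f x (y ∷ ys) =
    trans (cong (λ s → entry e x y ℤ.* s) (star-updateAt es i f x ys))
          (sym (ℤ.*-assoc (entry e x y) (star es x ys) (entry f x (lookup ys i))))

  star-removeAt : ∀ {k} (es : Vec BoseMesner (suc k)) i x ys →
    star es x ys ≡ entry (lookup es i) x (lookup ys i) ℤ.* star (removeAt es i) x (removeAt ys i)
  star-removeAt (e ∷ es)          zero    x (y ∷ ys)          = refl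
  star-removeAt (e ∷ es@(_ ∷ _)) (suc i) x (y ∷ ys@(_ ∷ _)) =
    trans (cong (λ s → entry e x y ℤ.* s) (star-removeAt es i x ys))
          (left-comm (entry e x y) (entry (lookup es i) x (lookup ys i)) _)

  value-overlay : ∀ {k} (M N : Net k) xs → value (overlay M N) xs ≡ value M xs ℤ.* value N xs
  value-overlay []       []       []       = refl
  value-overlay (es ▹ M) (fs ▹ N) (x ∷ xs) = begin
    star (zipWith _∘ᴮ_ es fs) x xs ℤ.* value (overlay M N) xs
      ≡⟨ cong₂ ℤ._*_ (star-zipWith es fs x xs) (value-overlay M N xs) ⟩
    (star es x xs ℤ.* star fs x xs) ℤ.* (value M xs ℤ.* value N xs)
      ≡⟨ interchange (star es x xs) (star fs x xs) (value M xs) (value N xs) ⟩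
    (star es x xs ℤ.* value M xs) ℤ.* (star fs x xs ℤ.* value N xs) ∎

  value-pull : ∀ {k} i (N : Net (suc k)) xs → value (pull i N) (front i xs) ≡ value N xs
  value-pull zero N (x ∷ xs) = refl
  value-pull (suc i) (es ▹ N) (x ∷ xs@(_ ∷ _)) with pull i N | value-pull i N xs
  ... | fs ▹ M | ih = begin
    (entry (lookup es i ᵀ) z x ℤ.* star fs z zs) ℤ.* (star (removeAt es i) x zs ℤ.* value M zs)
      ≡⟨ interchange (entry (lookup es i ᵀ) z x) (star fs z zs) (star (removeAt es i) x zs) (value M zs) ⟩
    (entry (lookup es i ᵀ) z x ℤ.* star (removeAt es i) x zs) ℤ.* (star fs z zs ℤ.* value M zs)
      ≡⟨ cong₂ ℤ._*_ (trans (cong (ℤ._* star (removeAt es i) x zs) (entry-ᵀ (lookup es i) z x)) (sym (star-removeAt es i x xs))) ih ⟩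
    star es x xs ℤ.* value N xs ∎
    where
    z = lookup xs i
    zs = removeAt xs i

  -- Removing the labels J - I of one vertex.

  contracted : ∀ {k} → List (Fin k × Net k) → Vertex → Vec Vertex k → ℤ
  contracted []             x ys = 0ℤ
  contracted ((i , M) ∷ Bs) x ys = δ x (lookup ys i) ℤ.* value M ys ℤ.+ contracted Bs x ys

  -- Where δ x z is nonzero, the label `e` from x to y is a label from z to y, that is, `e ᵀ` from y
  -- to z.
  contracted-extend : ∀ {k} e fs (Bs : List (Fin k × Net k)) x y ys →
    contracted (List.map (extend e fs) Bs) x (y ∷ ys) ≡ entry e x y ℤ.* star fs y ys ℤ.* contracted Bs x ys
  contracted-extend e fs []             x y ys = sym (ℤ.*-zeroʳ (entry e x y ℤ.* star fs y ys))
  contracted-extend e fs ((i , M) ∷ Bs) x y ys = begin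
    δ x z ℤ.* (star (updateAt fs i (_∘ᴮ e ᵀ)) y ys ℤ.* V) ℤ.+ contracted (List.map (extend e fs) Bs) x (y ∷ ys)
      ≡⟨ cong₂ (λ r s → δ x z ℤ.* (r ℤ.* V) ℤ.+ s)
           (trans (star-updateAt fs i (e ᵀ) y ys) (cong (λ s → F ℤ.* s) (entry-ᵀ e y z)))
           (contracted-extend e fs Bs x y ys) ⟩
    δ x z ℤ.* (F ℤ.* entry e z y ℤ.* V) ℤ.+ E ℤ.* F ℤ.* C
      ≡⟨ cong (ℤ._+ E ℤ.* F ℤ.* C) (gather (δ x z) F (entry e z y) V) ⟩
    δ x z ℤ.* entry e z y ℤ.* (F ℤ.* V) ℤ.+ E ℤ.* F ℤ.* C
      ≡⟨ cong (λ s → s ℤ.* (F ℤ.* V) ℤ.+ E ℤ.* F ℤ.* C) (sym (δ-subst x z (λ w → entry e w y))) ⟩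
    δ x z ℤ.* E ℤ.* (F ℤ.* V) ℤ.+ E ℤ.* F ℤ.* C
      ≡⟨ factor (δ x z) E F V C ⟩
    E ℤ.* F ℤ.* (δ x z ℤ.* V ℤ.+ C) ∎
    where
    z = lookup ys i
    E = entry e x y
    F = star fs y ys
    V = value M ys
    C = contracted Bs x ys
    gather : ∀ d f e v → d ℤ.* (f ℤ.* e ℤ.* v) ≡ d ℤ.* e ℤ.* (f ℤ.* v)
    gather = solve-∀
    factor : ∀ d e f v c → d ℤ.* e ℤ.* (f ℤ.* v) ℤ.+ e ℤ.* f ℤ.* c ≡ e ℤ.* f ℤ.* (d ℤ.* v ℤ.+ c)
    factor = solve-∀

  -- Telescoping: the product of the 1 - δᵢ equals 1 minus the sum over i of δᵢ times the product of
  -- the 1 - δⱼ with j > i. This costs one correction term per label instead of one per set of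
  -- labels.
  split : ∀ {k} (es : Vec BoseMesner k) N x ys →
    star es x ys ℤ.* value N ys ≡ star (Vec.map soften es) x ys ℤ.* value N ys ℤ.- contracted (contractions es N) x ys
  split [] [] x [] = refl
  split (e ∷ es) (fs ▹ N) x (y ∷ ys) with e ≟ᴮ 𝔻
  ... | yes refl = begin
    entry 𝔻 x y ℤ.* S ℤ.* (F ℤ.* V)
      ≡⟨ cong (λ r → r ℤ.* S ℤ.* (F ℤ.* V)) (entry-𝔻 x y) ⟩
    (1ℤ ℤ.- δ x y) ℤ.* S ℤ.* (F ℤ.* V)
      ≡⟨ separate (δ x y) S F V ⟩
    F ℤ.* (S ℤ.* V) ℤ.- δ x y ℤ.* S ℤ.* (F ℤ.* V)
      -- Only the first term is expanded further. The term with δ x y keeps the later labels J - I,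
      -- which pass from x to y.
      ≡⟨ cong₂ (λ r s → F ℤ.* r ℤ.- s ℤ.* (F ℤ.* V)) (split es N x ys) (δ-subst x y (λ w → star es w ys)) ⟩
    F ℤ.* (S′ ℤ.* V ℤ.- C) ℤ.- δ x y ℤ.* star es y ys ℤ.* (F ℤ.* V)
      ≡⟨ regroup (δ x y) (star es y ys) S′ F V C ⟩
    1ℤ ℤ.* S′ ℤ.* (F ℤ.* V) ℤ.- (δ x y ℤ.* (star es y ys ℤ.* F ℤ.* V) ℤ.+ 1ℤ ℤ.* F ℤ.* C)
      ≡⟨ cong₂ (λ r s → r ℤ.* S′ ℤ.* (F ℤ.* V) ℤ.- (δ x y ℤ.* (s ℤ.* V) ℤ.+ r ℤ.* F ℤ.* C))
           (sym (entry-𝕁 x y)) (sym (star-zipWith es fs y ys)) ⟩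
    entry 𝕁 x y ℤ.* S′ ℤ.* (F ℤ.* V) ℤ.- (δ x y ℤ.* (star (zipWith _∘ᴮ_ es fs) y ys ℤ.* V) ℤ.+ entry 𝕁 x y ℤ.* F ℤ.* C)
      ≡⟨ cong (λ s → entry 𝕁 x y ℤ.* S′ ℤ.* (F ℤ.* V) ℤ.- (δ x y ℤ.* (star (zipWith _∘ᴮ_ es fs) y ys ℤ.* V) ℤ.+ s))
           (sym (contracted-extend 𝕁 fs (contractions es N) x y ys)) ⟩
    entry 𝕁 x y ℤ.* S′ ℤ.* (F ℤ.* V) ℤ.- (δ x y ℤ.* (star (zipWith _∘ᴮ_ es fs) y ys ℤ.* V)
      ℤ.+ contracted (List.map (extend 𝕁 fs) (contractions es N)) x (y ∷ ys)) ∎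
    where
    S = star es x ys
    S′ = star (Vec.map soften es) x ys
    F = star fs y ys
    V = value N ys
    C = contracted (contractions es N) x ys
    separate : ∀ d s f v → (1ℤ ℤ.- d) ℤ.* s ℤ.* (f ℤ.* v) ≡ f ℤ.* (s ℤ.* v) ℤ.- d ℤ.* s ℤ.* (f ℤ.* v)
    separate = solve-∀
    regroup : ∀ d r s f v c → f ℤ.* (s ℤ.* v ℤ.- c) ℤ.- d ℤ.* r ℤ.* (f ℤ.* v) ≡
      1ℤ ℤ.* s ℤ.* (f ℤ.* v) ℤ.- (d ℤ.* (r ℤ.* f ℤ.* v) ℤ.+ 1ℤ ℤ.* f ℤ.* c)
    regroup = solve-∀
  ... | no _ = begin
    E ℤ.* S ℤ.* (F ℤ.* V)
      ≡⟨ interchange E S F V ⟩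
    E ℤ.* F ℤ.* (S ℤ.* V)
      ≡⟨ cong (λ s → E ℤ.* F ℤ.* s) (split es N x ys) ⟩
    E ℤ.* F ℤ.* (S′ ℤ.* V ℤ.- C)
      ≡⟨ distribute E F S′ V C ⟩
    E ℤ.* S′ ℤ.* (F ℤ.* V) ℤ.- E ℤ.* F ℤ.* C
      ≡⟨ cong (λ s → E ℤ.* S′ ℤ.* (F ℤ.* V) ℤ.- s) (sym (contracted-extend e fs (contractions es N) x y ys)) ⟩
    E ℤ.* S′ ℤ.* (F ℤ.* V) ℤ.- contracted (List.map (extend e fs) (contractions es N)) x (y ∷ ys) ∎
    where
    E = entry e x y
    S = star es x ys
    S′ = star (Vec.map soften es) x ys
    F = star fs y ys
    V = value N ys
    C = contracted (contractions es N) x ys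
    distribute : ∀ e f s v c → e ℤ.* f ℤ.* (s ℤ.* v ℤ.- c) ≡ e ℤ.* s ℤ.* (f ℤ.* v) ℤ.- e ℤ.* f ℤ.* c
    distribute = solve-∀

  -- Summing out one vertex.

  total : ∀ {k} → List (Fin k × Net k) → Vec Vertex k → ℤ
  total []             ys = 0ℤ
  total ((_ , M) ∷ Bs) ys = value M ys ℤ.+ total Bs ys

  sum-contracted : ∀ {k} (Bs : List (Fin k × Net k)) ys → sum (λ x → contracted Bs x ys) ≡ total Bs ys
  sum-contracted []             ys = sum-replicate-zero (4 * t + 3)
  sum-contracted ((i , M) ∷ Bs) ys =
    trans (∑-distrib-+ (λ x → δ x (lookup ys i) ℤ.* value M ys) (λ x → contracted Bs x ys))
          (cong₂ ℤ._+_ (sum-δ (lookup ys i) (λ _ → value M ys)) (sum-contracted Bs ys))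

  -- Here y is one neighbour of the summed vertex, and the other one, z, is searched for; their
  -- mutual label is multiplied by `e ⊙ s`. If no second label differs from J, the label J of some z
  -- takes its place, so vertices with fewer labels need no case of their own.
  attach : ∀ {k} e (es fs : Vec BoseMesner k) → Maybe (∃ λ gs → ∀ y ys →
    sum (λ x → entry e x y ℤ.* star es x ys) ℤ.* star fs y ys ≡ star gs y ys)
  attach e [] [] = nothing
  attach e (s ∷ es) (f ∷ fs) with Vec.≡-dec _≟ᴮ_ es (replicate _ 𝕁)
  ... | yes refl = just (f ∘ᴮ (e ⊙ s) ∷ fs , correct)
    where
    correct : ∀ y ys → sum (λ x → entry e x y ℤ.* star (s ∷ es) x ys) ℤ.* star (f ∷ fs) y ys ≡ star (f ∘ᴮ (e ⊙ s) ∷ fs) y ys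
    correct y (z ∷ ys) = begin
      sum (λ x → entry e x y ℤ.* (entry s x z ℤ.* star es x ys)) ℤ.* (entry f y z ℤ.* star fs y ys)
        ≡⟨ cong (ℤ._* (entry f y z ℤ.* star fs y ys)) (sum-cong-≗ (λ x → cong (λ r → entry e x y ℤ.* r)
             (trans (cong (λ r → entry s x z ℤ.* r) (star-𝕁 x ys)) (ℤ.*-identityʳ (entry s x z))))) ⟩
      sum (λ x → entry e x y ℤ.* entry s x z) ℤ.* (entry f y z ℤ.* star fs y ys)
        ≡⟨ cong (ℤ._* (entry f y z ℤ.* star fs y ys)) (sum-entry e s y z) ⟩
      entry (e ⊙ s) y z ℤ.* (entry f y z ℤ.* star fs y ys)
        ≡⟨ rearrange (entry (e ⊙ s) y z) (entry f y z) (star fs y ys) ⟩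
      entry f y z ℤ.* entry (e ⊙ s) y z ℤ.* star fs y ys
        ≡⟨ cong (ℤ._* star fs y ys) (sym (entry-∘ f (e ⊙ s) y z)) ⟩
      entry (f ∘ᴮ (e ⊙ s)) y z ℤ.* star fs y ys ∎
      where
      rearrange : ∀ x y z → x ℤ.* (y ℤ.* z) ≡ y ℤ.* x ℤ.* z
      rearrange = solve-∀
  ... | no _ with s ≟ᴮ 𝕁
  ...   | no _     = nothing
  ...   | yes refl = Maybe.map (λ (gs , p) → f ∷ gs , correct gs p) (attach e es fs)
    where
    correct : ∀ gs → (∀ y ys → sum (λ x → entry e x y ℤ.* star es x ys) ℤ.* star fs y ys ≡ star gs y ys) →
      ∀ y ys → sum (λ x → entry e x y ℤ.* star (𝕁 ∷ es) x ys) ℤ.* star (f ∷ fs) y ys ≡ star (f ∷ gs) y ys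
    correct gs p y (z ∷ ys) = begin
      sum (λ x → entry e x y ℤ.* (entry 𝕁 x z ℤ.* star es x ys)) ℤ.* (entry f y z ℤ.* star fs y ys)
        ≡⟨ cong (ℤ._* (entry f y z ℤ.* star fs y ys)) (sum-cong-≗ (λ x → cong (λ r → entry e x y ℤ.* r) (𝕁-star es x z ys))) ⟩
      sum (λ x → entry e x y ℤ.* star es x ys) ℤ.* (entry f y z ℤ.* star fs y ys)
        ≡⟨ left-comm (sum (λ x → entry e x y ℤ.* star es x ys)) (entry f y z) (star fs y ys) ⟩
      entry f y z ℤ.* (sum (λ x → entry e x y ℤ.* star es x ys) ℤ.* star fs y ys)
        ≡⟨ cong (λ r → entry f y z ℤ.* r) (p y ys) ⟩
      entry f y z ℤ.* star gs y ys ∎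

  -- Looks for the first of the two neighbours. A vertex where `attach` fails may be passed over
  -- only if its label is J; otherwise, in a network with at least two further vertices, three
  -- labels differ from J.
  absorb : ∀ {k} (es : Vec BoseMesner k) N → Maybe (∃ λ M → ∀ ys →
    sum (λ x → star es x ys) ℤ.* value N ys ≡ value M ys)
  absorb [] [] = nothing
  absorb (e ∷ es) (fs ▹ N) = Maybe.map (λ (gs , p) → gs ▹ N , attached gs p) (attach e es fs) <∣> skip (e ≟ᴮ 𝕁)
    where
    attached : ∀ gs → (∀ y ys → sum (λ x → entry e x y ℤ.* star es x ys) ℤ.* star fs y ys ≡ star gs y ys) →
      ∀ ys → sum (λ x → star (e ∷ es) x ys) ℤ.* value (fs ▹ N) ys ≡ value (gs ▹ N) ys
    attached gs p (y ∷ ys) =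
      trans (sym (ℤ.*-assoc (sum (λ x → entry e x y ℤ.* star es x ys)) (star fs y ys) (value N ys)))
            (cong (ℤ._* value N ys) (p y ys))
    skipped : e ≡ 𝕁 → ∀ M → (∀ ys → sum (λ x → star es x ys) ℤ.* value N ys ≡ value M ys) →
      ∀ ys → sum (λ x → star (e ∷ es) x ys) ℤ.* value (fs ▹ N) ys ≡ value (fs ▹ M) ys
    skipped refl M p (y ∷ ys) = begin
      sum (λ x → entry 𝕁 x y ℤ.* star es x ys) ℤ.* (star fs y ys ℤ.* value N ys)
        ≡⟨ cong (ℤ._* (star fs y ys ℤ.* value N ys)) (sum-cong-≗ (λ x → 𝕁-star es x y ys)) ⟩
      sum (λ x → star es x ys) ℤ.* (star fs y ys ℤ.* value N ys)
        ≡⟨ left-comm (sum (λ x → star es x ys)) (star fs y ys) (value N ys) ⟩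
      star fs y ys ℤ.* (sum (λ x → star es x ys) ℤ.* value N ys)
        ≡⟨ cong (λ r → star fs y ys ℤ.* r) (p ys) ⟩
      star fs y ys ℤ.* value M ys ∎
    skip : Dec (e ≡ 𝕁) → Maybe (∃ λ M → ∀ ys → sum (λ x → star (e ∷ es) x ys) ℤ.* value (fs ▹ N) ys ≡ value M ys)
    skip (no _)    = nothing
    skip (yes e≡𝕁) = Maybe.map (λ (M , p) → fs ▹ M , skipped e≡𝕁 M p) (absorb es N)

  -- Labels J - I do not count towards the limit of two, since they are softened first. The price is
  -- the subtracted networks, which also have one vertex fewer.
  eliminate : ∀ {k} (es : Vec BoseMesner k) N → Maybe (∃ λ M → ∀ ys →
    sum (λ x → value (es ▹ N) (x ∷ ys)) ≡ value M ys ℤ.- total (contractions es N) ys)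
  eliminate es N = Maybe.map (λ (M , p) → M , correct M p) (absorb (Vec.map soften es) N)
    where
    correct : ∀ M → (∀ ys → sum (λ x → star (Vec.map soften es) x ys) ℤ.* value N ys ≡ value M ys) →
      ∀ ys → sum (λ x → star es x ys ℤ.* value N ys) ≡ value M ys ℤ.- total (contractions es N) ys
    correct M p ys = begin
      sum (λ x → star es x ys ℤ.* value N ys)
        ≡⟨ sum-cong-≗ (λ x → split es N x ys) ⟩
      sum (λ x → star (Vec.map soften es) x ys ℤ.* value N ys ℤ.- contracted (contractions es N) x ys)
        ≡⟨ sum-minus (λ x → star (Vec.map soften es) x ys ℤ.* value N ys) (λ x → contracted (contractions es N) x ys) ⟩
      sum (λ x → star (Vec.map soften es) x ys ℤ.* value N ys) ℤ.- sum (λ x → contracted (contractions es N) x ys)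
        ≡⟨ cong₂ ℤ._-_ (trans (sym (*-distribʳ-sum (value N ys) (λ x → star (Vec.map soften es) x ys))) (p ys))
                       (sum-contracted (contractions es N) ys) ⟩
      value M ys ℤ.- total (contractions es N) ys ∎

  -- The evaluation procedure.

  star-vanishes : ∀ {k} (es : Vec BoseMesner k) → Maybe (∀ x ys → star es x ys ≡ 0ℤ)
  star-vanishes []       = nothing
  star-vanishes (e ∷ es) with e ≟ᴮ 𝟘
  ... | yes refl = just λ { x (y ∷ ys) → refl }
  ... | no _     = Maybe.map (λ { p x (y ∷ ys) → trans (cong (λ s → entry e x y ℤ.* s) (p x ys)) (ℤ.*-zeroʳ (entry e x y)) })
                             (star-vanishes es)

  -- Zero labels arise when an identification puts both A and Aᵀ on one pair, as happens for two
  -- vertices at distance two on the cycle. Such a network is settled without summing out any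
  -- further vertex.
  vanishes : ∀ {k} (N : Net k) → Maybe (∀ xs → value N xs ≡ 0ℤ)
  vanishes []       = nothing
  vanishes (es ▹ N) =
    Maybe.map (λ { p (x ∷ xs) → cong (ℤ._* value N xs) (p x xs) }) (star-vanishes es) <∣>
    Maybe.map (λ { p (x ∷ xs) → trans (cong (λ s → star es x xs ℤ.* s) (p xs)) (ℤ.*-zeroʳ (star es x xs)) }) (vanishes N)

  -- Which vertex has few enough labels to be summed out depends on the
  -- identifications made before, so evaluate tries to pull each one to the top.
  Evaluates : ∀ m → (Vec Vertex (m + 2) → ℤ) → BoseMesner → Set
  Evaluates m F r = ∀ u v → ∑ m (λ xs → F (xs ++ u ∷ v ∷ [])) ≡ entry r u v

  evaluate    : ∀ m (N : Net (m + 2)) → Maybe (∃ (Evaluates m (value N)))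
  evaluateAll : ∀ m (Bs : List (Fin (m + 2) × Net (m + 2))) → Maybe (∃ (Evaluates m (total Bs)))

  evaluate zero ((e ∷ []) ▹ [] ▹ []) = just (e , λ u v → units (entry e u v))
    where
    units : ∀ x → x ℤ.* 1ℤ ℤ.* (1ℤ ℤ.* 1ℤ) ≡ x
    units = solve-∀
  evaluate (suc m) N =
    Maybe.map (λ p → 𝟘 , λ u v → trans (∑-cong (suc m) (λ xs → p (xs ++ u ∷ v ∷ []))) (∑-zero {4 * t + 3} (suc m))) (vanishes N) <∣>
    -- `elimination` includes all recursive evaluations, so a choice that gets stuck later is also
    -- withdrawn. Only the first m + 1 vertices are candidates; the last two are u and v.
    firstJust (λ i → Maybe.map (λ (r , p) → r , pulled i r p) (elimination (pull (i ↑ˡ 2) N)))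
    where
    pulled : ∀ i r → Evaluates (suc m) (value (pull (i ↑ˡ 2) N)) r → Evaluates (suc m) (value N) r
    pulled i r p u v = begin
      ∑ (suc m) (λ xs → value N (xs ++ u ∷ v ∷ []))
        ≡⟨ ∑-cong (suc m) (λ xs → sym (value-pull (i ↑ˡ 2) N (xs ++ u ∷ v ∷ []))) ⟩
      ∑ (suc m) (λ xs → value (pull (i ↑ˡ 2) N) (front (i ↑ˡ 2) (xs ++ u ∷ v ∷ [])))
        ≡⟨ ∑-front m i (value (pull (i ↑ˡ 2) N)) (u ∷ v ∷ []) ⟩
      ∑ (suc m) (λ xs → value (pull (i ↑ˡ 2) N) (xs ++ u ∷ v ∷ []))
        ≡⟨ p u v ⟩
      entry r u v ∎

    elimination : (N : Net (suc (m + 2))) → Maybe (∃ (Evaluates (suc m) (value N)))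
    elimination (es ▹ N) =
      eliminate es N                       >>= λ (M , p) →
      evaluate m M                         >>= λ (r , q) →
      evaluateAll m (contractions es N)    >>= λ (s , q′) →
      just (r ⊝ s , λ u v → begin
        sum (λ x → ∑ m (λ xs → value (es ▹ N) (x ∷ xs ++ u ∷ v ∷ [])))
          ≡⟨ sum-∑ m (λ x xs → value (es ▹ N) (x ∷ xs ++ u ∷ v ∷ [])) ⟩
        ∑ m (λ xs → sum (λ x → value (es ▹ N) (x ∷ xs ++ u ∷ v ∷ [])))
          ≡⟨ ∑-cong m (λ xs → p (xs ++ u ∷ v ∷ [])) ⟩
        ∑ m (λ xs → value M (xs ++ u ∷ v ∷ []) ℤ.- total (contractions es N) (xs ++ u ∷ v ∷ []))
          ≡⟨ ∑-minus m _ _ ⟩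
        ∑ m (λ xs → value M (xs ++ u ∷ v ∷ [])) ℤ.- ∑ m (λ xs → total (contractions es N) (xs ++ u ∷ v ∷ []))
          ≡⟨ cong₂ ℤ._-_ (q u v) (q′ u v) ⟩
        entry r u v ℤ.- entry s u v
          ≡⟨ sym (entry-⊝ r s u v) ⟩
        entry (r ⊝ s) u v ∎)

  evaluateAll m [] = just (𝟘 , λ u v → ∑-zero {4 * t + 3} m)
  evaluateAll m ((_ , M) ∷ Bs) =
    evaluate m M     >>= λ (r , p) →
    evaluateAll m Bs >>= λ (s , q) →
    just (r ⊞ s , λ u v → begin
      ∑ m (λ xs → value M (xs ++ u ∷ v ∷ []) ℤ.+ total Bs (xs ++ u ∷ v ∷ []))
        ≡⟨ ∑-plus m _ _ ⟩
      ∑ m (λ xs → value M (xs ++ u ∷ v ∷ [])) ℤ.+ ∑ m (λ xs → total Bs (xs ++ u ∷ v ∷ []))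
        ≡⟨ cong₂ ℤ._+_ (p u v) (q u v) ⟩
      entry r u v ℤ.+ entry s u v
        ≡⟨ sym (entry-⊞ r s u v) ⟩
      entry (r ⊞ s) u v ∎)

  -- Cycle sequences as networks.

  private
    through-arc : ∀ {k} x y (ys : Vec Vertex k) → star (𝔸 ∷ replicate k 𝕁) x (y ∷ ys) ≡ a x y
    through-arc x y ys = trans (cong₂ ℤ._*_ (entry-𝔸 x y) (star-𝕁 x ys)) (ℤ.*-identityʳ (a x y))

  ind-freshIn : ∀ {k} x (ys : Vec Vertex k) → ind (freshIn x ys) ≡ star (replicate k 𝔻) x ys
  ind-freshIn x []       = refl
  ind-freshIn x (y ∷ ys) = begin
    ind (not ⌊ x ≟ y ⌋ ∧ freshIn x ys)         ≡⟨ ind-∧ (not ⌊ x ≟ y ⌋) (freshIn x ys) ⟩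
    ind (not ⌊ x ≟ y ⌋) ℤ.* ind (freshIn x ys) ≡⟨ cong₂ ℤ._*_ (trans (ind-not ⌊ x ≟ y ⌋) (sym (entry-𝔻 x y))) (ind-freshIn x ys) ⟩
    entry 𝔻 x y ℤ.* star (replicate _ 𝔻) x ys ∎
    where
    ind-not : ∀ b → ind (not b) ≡ 1ℤ ℤ.- ind b
    ind-not true  = refl
    ind-not false = refl

  ind-distinct : ∀ {k} (xs : Vec Vertex k) → ind (distinct xs) ≡ value (allDistinct k) xs
  ind-distinct []       = refl
  ind-distinct (x ∷ xs) =
    trans (ind-∧ (freshIn x xs) (distinct xs)) (cong₂ ℤ._*_ (ind-freshIn x xs) (ind-distinct xs))

  -- The first vertex x stays fixed while y moves along the path: the row of x records only the
  -- closing arc, and the chain records the steps.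
  ind-pathToClose : ∀ {k} x y (ys : Vec Vertex k) →
    ind (pathToClose τ x y ys) ≡ star (closing k) x (y ∷ ys) ℤ.* value (chain (suc k)) (y ∷ ys)
  ind-pathToClose x y [] = trans (sym (entry-𝔸ᵀ x y)) (units (entry 𝔸ᵀ x y))
    where
    units : ∀ e → e ≡ e ℤ.* 1ℤ ℤ.* (1ℤ ℤ.* 1ℤ)
    units = solve-∀
  ind-pathToClose {suc k} x y (z ∷ ys) = begin
    ind (arc τ y z ∧ pathToClose τ x z ys)
      ≡⟨ ind-∧ (arc τ y z) (pathToClose τ x z ys) ⟩
    a y z ℤ.* ind (pathToClose τ x z ys)
      ≡⟨ cong₂ ℤ._*_ (sym (through-arc y z ys)) (ind-pathToClose x z ys) ⟩
    star (𝔸 ∷ replicate _ 𝕁) y (z ∷ ys) ℤ.* (star (closing k) x (z ∷ ys) ℤ.* value (chain (suc k)) (z ∷ ys))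
      ≡⟨ left-comm (star (𝔸 ∷ replicate _ 𝕁) y (z ∷ ys)) (star (closing k) x (z ∷ ys)) _ ⟩
    star (closing k) x (z ∷ ys) ℤ.* value (chain (suc (suc k))) (y ∷ z ∷ ys)
      ≡⟨ cong (ℤ._* value (chain (suc (suc k))) (y ∷ z ∷ ys)) (sym (𝕁-star (closing k) x y (z ∷ ys))) ⟩
    star (closing (suc k)) x (y ∷ z ∷ ys) ℤ.* value (chain (suc (suc k))) (y ∷ z ∷ ys) ∎

  ind-isCycleSeq : ∀ {k} (xs : Vec Vertex (2 + k)) → ind (isCycleSeq τ xs) ≡ value (cycleNet k) xs
  ind-isCycleSeq {k} xs@(x ∷ ys@(y ∷ zs)) = begin
    ind (distinct xs ∧ (arc τ x y ∧ pathToClose τ x y zs))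
      ≡⟨ trans (ind-∧ (distinct xs) _) (cong (λ s → ind (distinct xs) ℤ.* s) (ind-∧ (arc τ x y) _)) ⟩
    ind (distinct xs) ℤ.* (a x y ℤ.* ind (pathToClose τ x y zs))
      ≡⟨ cong₂ ℤ._*_ (ind-distinct xs) (cong₂ ℤ._*_ (sym (through-arc x y zs)) (ind-pathToClose x y zs)) ⟩
    D ℤ.* (star (𝔸 ∷ replicate k 𝕁) x ys ℤ.* (star (closing k) x ys ℤ.* C))
      ≡⟨ cong (λ s → D ℤ.* s) (rearrange (star (𝔸 ∷ replicate k 𝕁) x ys) (star (closing k) x ys) C) ⟩
    D ℤ.* (star (closing k) x ys ℤ.* star (𝔸 ∷ replicate k 𝕁) x ys ℤ.* C)
      ≡⟨ cong (λ s → D ℤ.* (s ℤ.* C)) (sym (star-zipWith (closing k) (𝔸 ∷ replicate k 𝕁) x ys)) ⟩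
    D ℤ.* value R xs
      ≡⟨ sym (value-overlay (allDistinct (2 + k)) R xs) ⟩
    value (cycleNet k) xs ∎
    where
    D = value (allDistinct (2 + k)) xs
    C = value (chain (suc k)) ys
    R = zipWith _∘ᴮ_ (closing k) (𝔸 ∷ replicate k 𝕁) ▹ chain (suc k)
    rearrange : ∀ p q c → p ℤ.* (q ℤ.* c) ≡ q ℤ.* p ℤ.* c
    rearrange = solve-∀

  -- The number of 8-cycles through an arc.

  entry-arc : ∀ r u v → arc τ u v ≡ true → entry r u v ≡ ⟪ proj₁ (proj₂ r) ⟫ T
  entry-arc r@(d , p , m) u v u→v =
    by-position (⟪ d ⟫ T) (⟪ p ⟫ T) (⟪ m ⟫ T) (position τ u v) (cong ind u→v)
    where
    by-position : ∀ d p m {e f b} → Position e f b → f ≡ 1ℤ → d ℤ.* e ℤ.+ p ℤ.* f ℤ.+ m ℤ.* b ≡ p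
    -- In the other two positions the entry of A is 0, contrary to `f ≡ 1ℤ`.
    by-position d p m forward _ = solve (d List.∷ p List.∷ m List.∷ List.[])

  -- The equation mentions only the coefficient at A, so it can be checked by computation without
  -- comparing correctness proofs.
  arc-polynomial : ∀ {m F} (e : Maybe (∃ (Evaluates m F))) {p} →
    Maybe.map (λ (r , _) → proj₁ (proj₂ r)) e ≡ just p →
    ∀ u v → arc τ u v ≡ true → ∑ m (λ xs → F (xs ++ u ∷ v ∷ [])) ≡ ⟪ p ⟫ T
  arc-polynomial (just (r , correct)) refl u v u→v = trans (correct u v) (entry-arc r u v u→v)

  -- Only leading vertices are summed over, so u and v are first moved to the end.
  cyclesThroughArc-8 : ∀ u v → arc τ u v ≡ true →
    + cyclesThroughArc τ 8 u v ≡ ⟪ octagons ⟫ T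
  cyclesThroughArc-8 u v u→v = begin
    + cyclesThroughArc τ 8 u v
      ≡⟨ length-filter-allVecs 6 (λ xs → isCycleSeq τ (u ∷ v ∷ xs)) ⟩
    ∑ 6 (λ xs → ind (isCycleSeq τ (u ∷ v ∷ xs)))
      ≡⟨ ∑-cong 6 (λ xs → trans (ind-isCycleSeq (u ∷ v ∷ xs)) (sym (rotated xs))) ⟩
    ∑ 6 (λ xs → value N₆ (xs ++ u ∷ v ∷ []))
      -- The `refl` runs the whole computation: it checks both that `evaluate` succeeds and that the
      -- coefficient at A is `octagons`.
      ≡⟨ arc-polynomial {m = 6} {F = value N₆} (evaluate 6 N₆) {octagons} refl u v u→v ⟩
    ⟪ octagons ⟫ T ∎
    where
    last : Fin 8
    last = fromℕ 7
    N₀ N₁ N₂ N₃ N₄ N₅ N₆ : Net 8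
    N₀ = cycleNet 6
    -- Pulling the last vertex to the front is a rotation; six of them bring all of x₂, ..., x₇
    -- before u and v.
    N₁ = pull last N₀
    N₂ = pull last N₁
    N₃ = pull last N₂
    N₄ = pull last N₃
    N₅ = pull last N₄
    N₆ = pull last N₅
    rotated : ∀ xs → value N₆ (xs ++ u ∷ v ∷ []) ≡ value N₀ (u ∷ v ∷ xs)
    rotated (x₂ ∷ x₃ ∷ x₄ ∷ x₅ ∷ x₆ ∷ x₇ ∷ []) = begin
      value N₆ (x₂ ∷ x₃ ∷ x₄ ∷ x₅ ∷ x₆ ∷ x₇ ∷ u ∷ v ∷ []) ≡⟨ value-pull last N₅ (x₃ ∷ x₄ ∷ x₅ ∷ x₆ ∷ x₇ ∷ u ∷ v ∷ x₂ ∷ []) ⟩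
      value N₅ (x₃ ∷ x₄ ∷ x₅ ∷ x₆ ∷ x₇ ∷ u ∷ v ∷ x₂ ∷ []) ≡⟨ value-pull last N₄ (x₄ ∷ x₅ ∷ x₆ ∷ x₇ ∷ u ∷ v ∷ x₂ ∷ x₃ ∷ []) ⟩
      value N₄ (x₄ ∷ x₅ ∷ x₆ ∷ x₇ ∷ u ∷ v ∷ x₂ ∷ x₃ ∷ []) ≡⟨ value-pull last N₃ (x₅ ∷ x₆ ∷ x₇ ∷ u ∷ v ∷ x₂ ∷ x₃ ∷ x₄ ∷ []) ⟩
      value N₃ (x₅ ∷ x₆ ∷ x₇ ∷ u ∷ v ∷ x₂ ∷ x₃ ∷ x₄ ∷ []) ≡⟨ value-pull last N₂ (x₆ ∷ x₇ ∷ u ∷ v ∷ x₂ ∷ x₃ ∷ x₄ ∷ x₅ ∷ []) ⟩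
      value N₂ (x₆ ∷ x₇ ∷ u ∷ v ∷ x₂ ∷ x₃ ∷ x₄ ∷ x₅ ∷ []) ≡⟨ value-pull last N₁ (x₇ ∷ u ∷ v ∷ x₂ ∷ x₃ ∷ x₄ ∷ x₅ ∷ x₆ ∷ []) ⟩
      value N₁ (x₇ ∷ u ∷ v ∷ x₂ ∷ x₃ ∷ x₄ ∷ x₅ ∷ x₆ ∷ []) ≡⟨ value-pull last N₀ (u ∷ v ∷ x₂ ∷ x₃ ∷ x₄ ∷ x₅ ∷ x₆ ∷ x₇ ∷ []) ⟩
      value N₀ (u ∷ v ∷ x₂ ∷ x₃ ∷ x₄ ∷ x₅ ∷ x₆ ∷ x₇ ∷ []) ∎

-- The polynomial in factored form, over the natural numbers.

-- The subtractions on the right are truncated. For t = 0 both sides vanish; for t = s + 1 the last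
-- factor is 16 s² + 28 s + 1, so nothing is cut off.
formula : ∀ t →
  ⟪ octagons ⟫ (+ t) ≡
  + (2 * (t + 1) * (t ∸ 1) * t ^ 2 * (16 * t ^ 2 ∸ 4 * t ∸ 11))
formula zero    = refl
formula (suc s) = begin
  ⟪ octagons ⟫ (1ℤ ℤ.+ S)
    ≡⟨ factorise S ⟩
  + 2 ℤ.* (1ℤ ℤ.+ S ℤ.+ 1ℤ) ℤ.* S ℤ.* ((1ℤ ℤ.+ S) ℤ.* ((1ℤ ℤ.+ S) ℤ.* 1ℤ)) ℤ.* (+ 16 ℤ.* (S ℤ.* S) ℤ.+ + 28 ℤ.* S ℤ.+ 1ℤ)
    ≡⟨ sym push ⟩
  + (2 * (suc s + 1) * s * suc s ^ 2 * (16 * (s * s) + 28 * s + 1))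
    ≡⟨ cong (λ q → + (2 * (suc s + 1) * s * suc s ^ 2 * q)) (sym quotient) ⟩
  + (2 * (suc s + 1) * s * suc s ^ 2 * (16 * suc s ^ 2 ∸ 4 * suc s ∸ 11)) ∎
  where
  S = + s
  factorise : ∀ S →
    0ℤ ℤ.+ (1ℤ ℤ.+ S) ℤ.* (0ℤ ℤ.+ (1ℤ ℤ.+ S) ℤ.* (+ 22 ℤ.+ (1ℤ ℤ.+ S) ℤ.* (+ 8 ℤ.+ (1ℤ ℤ.+ S) ℤ.*
      (- + 54 ℤ.+ (1ℤ ℤ.+ S) ℤ.* (- + 8 ℤ.+ (1ℤ ℤ.+ S) ℤ.* (+ 32 ℤ.+ (1ℤ ℤ.+ S) ℤ.* 0ℤ)))))) ≡
    + 2 ℤ.* (1ℤ ℤ.+ S ℤ.+ 1ℤ) ℤ.* S ℤ.* ((1ℤ ℤ.+ S) ℤ.* ((1ℤ ℤ.+ S) ℤ.* 1ℤ)) ℤ.* (+ 16 ℤ.* (S ℤ.* S) ℤ.+ + 28 ℤ.* S ℤ.+ 1ℤ)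
  factorise = solve-∀
  infixl 7 _⟨*⟩_
  _⟨*⟩_ : ∀ {m n x y} → + m ≡ x → + n ≡ y → + (m * n) ≡ x ℤ.* y
  _⟨*⟩_ {m} {n} refl refl = ℤ.pos-* m n
  push : + (2 * (suc s + 1) * s * suc s ^ 2 * (16 * (s * s) + 28 * s + 1)) ≡
    + 2 ℤ.* (1ℤ ℤ.+ S ℤ.+ 1ℤ) ℤ.* S ℤ.* ((1ℤ ℤ.+ S) ℤ.* ((1ℤ ℤ.+ S) ℤ.* 1ℤ)) ℤ.* (+ 16 ℤ.* (S ℤ.* S) ℤ.+ + 28 ℤ.* S ℤ.+ 1ℤ)
  push = nat 2 ⟨*⟩ nat (suc s + 1) ⟨*⟩ nat s ⟨*⟩ (nat (suc s) ⟨*⟩ (nat (suc s) ⟨*⟩ nat 1)) ⟨*⟩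
    cong (ℤ._+ 1ℤ) (cong₂ ℤ._+_ (nat 16 ⟨*⟩ (nat s ⟨*⟩ nat s)) (nat 28 ⟨*⟩ nat s))
    where
    nat : ∀ n → + n ≡ + n
    nat n = refl
  quotient : 16 * suc s ^ 2 ∸ 4 * suc s ∸ 11 ≡ 16 * (s * s) + 28 * s + 1
  quotient = begin
    16 * suc s ^ 2 ∸ 4 * suc s ∸ 11
      -- The minuend is rewritten with both subtrahends as explicit summands, so that each
      -- subtraction cancels exactly.
      ≡⟨ cong (λ q → q ∸ 4 * suc s ∸ 11) (expand s) ⟩
    16 * (s * s) + 28 * s + 1 + 11 + 4 * suc s ∸ 4 * suc s ∸ 11
      ≡⟨ cong (_∸ 11) (ℕ.m+n∸n≡m (16 * (s * s) + 28 * s + 1 + 11) (4 * suc s)) ⟩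
    16 * (s * s) + 28 * s + 1 + 11 ∸ 11
      ≡⟨ ℕ.m+n∸n≡m (16 * (s * s) + 28 * s + 1) 11 ⟩
    16 * (s * s) + 28 * s + 1 ∎
    where
    expand : ∀ s → 16 * (suc s * (suc s * 1)) ≡ 16 * (s * s) + 28 * s + 1 + 11 + 4 * suc s
    expand = ℕSolver.solve-∀

theorem1 : (t : ℕ) (τ : Tournament (4 * t + 3)) → DoublyRegular τ →
    (u v : Fin (4 * t + 3)) → arc τ u v ≡ true →
    cyclesThroughArc τ 8 u v
    ≡ 2 * (t + 1) * (t ∸ 1) * t ^ 2 * (16 * t ^ 2 ∸ 4 * t ∸ 11)
theorem1 t τ dr u v u→v = ℤ.+-injective (trans (cyclesThroughArc-8 u v u→v) (formula t))
  where open DoublyRegularTournament t τ dr
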